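{- Let $\Phi$ be the root system $\mathrm{G}_2$ with short simple root $\alpha_1$ and long simple root $\alpha_2$, and let $\Phi_s,\Phi_l$ (respectively $\Phi_s^+,\Phi_l^+$) be the sets of short and long roots (respectively positive short and positive long roots). Define \[ G(K,M)=\frac13\,\frac{(3K+3M)!!\,(3K)!!\,(2K)!!\,(2M)!!}{(3K+2M)!!\,(2K+M)!!\,(K+M)!!\,K!!\,K!!\,M!!}. \] Then for all nonnegative integers $k,m$, \[ \mathrm{CT}\bigg[\mathrm{e}^{ -3\alpha_1-2\alpha_2}\log(1-\mathrm{e}^{\alpha_2})\prod_{\alpha\in\Phi_l^+}(1-\mathrm{e}^{\alpha})\prod_{\alpha\in\Phi_l}(1-\mathrm{e}^{\alpha})^k\prod_{\alpha\in\Phi_s}(1-\mathrm{e}^{\alpha})^m\bigg]=G(K,M)\quad\text{with }(K,M):=(2k+1,2m), \] and \[ \mathrm{CT}\bigg[\mathrm{e}^{ -2\alpha_1-\alpha_2}\log(1-\mathrm{e}^{\alpha_1})\prod_{\alpha\in\Phi_s^+}(1-\mathrm{e}^{\alpha})\prod_{\alpha\in\Phi_l}(1-\mathrm{e}^{\alpha})^k\prod_{\alpha\in\Phi_s}(1-\mathrm{e}^{\alpha})^m\bigg]=G(K,M)\quad\text{with }(K,M):=(2k,2m+1). \]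
   Context: With $\epsilon_i$ the standard unit vectors of $\mathbb{R}^3$, the simple roots of $\mathrm{G}_2$ are $\alpha_1=\epsilon_1-\epsilon_2$ and $\alpha_2=2\epsilon_2-\epsilon_1-\epsilon_3$. The positive short roots are $\alpha_1$, $\alpha_1+\alpha_2=\epsilon_2-\epsilon_3$, $2\alpha_1+\alpha_2=\epsilon_1-\epsilon_3$. The positive long roots are $\alpha_2$, $3\alpha_1+\alpha_2=2\epsilon_1-\epsilon_2-\epsilon_3$, $3\alpha_1+2\alpha_2=\epsilon_1+\epsilon_2-2\epsilon_3$. The remaining roots are the negatives of these. The $\mathrm{e}^{\lambda}$ are formal exponentials with $\mathrm{e}^{\lambda}\mathrm{e}^{\mu}=\mathrm{e}^{\lambda+\mu}$; equivalently $\mathrm{e}^{\epsilon_1}=x$, $\mathrm{e}^{\epsilon_2}=y$, $\mathrm{e}^{\epsilon_3}=z$, so that $\mathrm{e}^{\alpha_1}=x/y$ and $\mathrm{e}^{\alpha_2}=y^2/(xz)$. $\mathrm{CT}$ denotes the constant term, i.e. the coefficient of $\mathrm{e}^0$, and $\log(1-w)=-\sum_{N\ge1}w^N/N$ as a formal power series in $w=\mathrm{e}^{\alpha_i}$. $N!!$ is the double factorial, with $0!!=1$. -}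

module Defs where

open import Data.Bool.Base using (if_then_else_)
open import Data.Integer.Base as ℤ using (ℤ; +_; 0ℤ; 1ℤ)
import Data.Integer.Properties as ℤ
open import Data.List.Base as List using (List; []; _∷_; _++_; upTo; cartesianProductWith)
open import Data.Nat.Base using (ℕ; zero; suc; _+_; _*_; NonZero)
open import Data.Nat.Properties using (m*n≢0)
open import Data.Product.Base using (_×_; _,_)
open import Data.Rational.Base as ℚ using (ℚ; 0ℚ; 1ℚ; _/_)
open import Data.Vec.Base as Vec using (Vec; []; _∷_)
open import Data.Vec.Properties using (≡-dec)
open import Relation.Binary.Definitions using (DecidableEquality)
open import Relation.Binary.PropositionalEquality using (_≡_; refl)
open import Relation.Nullary.Decidable.Core using (⌊_⌋)

-- All exponents lie in the lattice ℤ³ ⊂ ℝ³.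

Weight : Set
Weight = Vec ℤ 3

infix  8 ⊖_
infixr 7 _·_
infixl 6 _⊕_ _⊝_
infix  4 _≟_

_⊕_ : Weight → Weight → Weight
_⊕_ = Vec.zipWith ℤ._+_

⊖_ : Weight → Weight
⊖_ = Vec.map (λ a → ℤ.- a)

_⊝_ : Weight → Weight → Weight
u ⊝ v = u ⊕ ⊖ v

_·_ : ℕ → Weight → Weight
n · v = Vec.map (λ a → + n ℤ.* a) v

𝟎 : Weight
𝟎 = Vec.replicate 3 0ℤ

_≟_ : DecidableEquality Weight
_≟_ = ≡-dec ℤ._≟_

∥_∥₁ : Weight → ℕ
∥ v ∥₁ = Vec.sum (Vec.map ℤ.∣_∣ v)

ε₁ ε₂ ε₃ : Weight
ε₁ = 1ℤ ∷ 0ℤ ∷ 0ℤ ∷ []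
ε₂ = 0ℤ ∷ 1ℤ ∷ 0ℤ ∷ []
ε₃ = 0ℤ ∷ 0ℤ ∷ 1ℤ ∷ []

α₁ α₂ : Weight
α₁ = ε₁ ⊝ ε₂
α₂ = 2 · ε₂ ⊝ ε₁ ⊝ ε₃

-- Each list is free of repetitions, so that a product over the list is the
-- product over the set of roots.
Φₛ⁺ Φₗ⁺ Φₛ Φₗ : List Weight
Φₛ⁺ = α₁ ∷ α₁ ⊕ α₂ ∷ 2 · α₁ ⊕ α₂ ∷ []
Φₗ⁺ = α₂ ∷ 3 · α₁ ⊕ α₂ ∷ 3 · α₁ ⊕ 2 · α₂ ∷ []
Φₛ  = Φₛ⁺ ++ List.map ⊖_ Φₛ⁺
Φₗ  = Φₗ⁺ ++ List.map ⊖_ Φₗ⁺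

_ : Φₛ⁺ ≡ ε₁ ⊝ ε₂ ∷ ε₂ ⊝ ε₃ ∷ ε₁ ⊝ ε₃ ∷ []
_ = refl

_ : Φₗ⁺ ≡ 2 · ε₂ ⊝ ε₁ ⊝ ε₃ ∷ 2 · ε₁ ⊝ ε₂ ⊝ ε₃ ∷ ε₁ ⊕ ε₂ ⊝ 2 · ε₃ ∷ []
_ = refl

-- Laurent polynomials in the formal exponentials e^λ: a list of terms
-- (c , λ) stands for the sum of the c e^λ.  Like terms need not be collected.

Laurent : Set
Laurent = List (ℚ × Weight)

infixr 8 _^_
infixl 7 _⊛_

e^_ : Weight → Laurent
e^ v = (1ℚ , v) ∷ []

one : Laurent
one = e^ 𝟎

_⊛_ : Laurent → Laurent → Laurent
_⊛_ = cartesianProductWith λ (c , u) (d , v) → (c ℚ.* d , u ⊕ v)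

_^_ : Laurent → ℕ → Laurent
p ^ zero  = one
p ^ suc n = p ⊛ p ^ n

1-e^_ : Weight → Laurent
1-e^ v = (1ℚ , 𝟎) ∷ (ℚ.- 1ℚ , v) ∷ []

∏ : List Weight → (Weight → Laurent) → Laurent
∏ vs f = List.foldr (λ v p → f v ⊛ p) one vs

-- Formal, possibly infinite sums Σ c_λ e^λ, given by λ ↦ c_λ.

Formal : Set
Formal = Weight → ℚ

∑ : List ℚ → ℚ
∑ = List.foldr ℚ._+_ 0ℚ

-- Two arbitrary formal sums cannot be multiplied, but a Laurent polynomial
-- and a formal sum can: [e^λ] (Σᵢ cᵢ e^μᵢ) F = Σᵢ cᵢ [e^(λ-μᵢ)] F.
-- This is a module action, so p ⋆ (q ⋆ F) is the product p q F.

infixr 6 _⋆_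

_⋆_ : Laurent → Formal → Formal
(p ⋆ F) v = ∑ (List.map (λ (c , u) → c ℚ.* F (v ⊝ u)) p)

CT : Formal → ℚ
CT F = F 𝟎

-- The power series Σ f_N w^N at w = e^β, for β ≠ 0: the coefficient of e^λ is
-- the sum of the f_N with N β = λ.  Since β is a nonzero integer vector,
-- N β = λ forces N ≤ ∥ λ ∥₁, so the finite range of N loses nothing.

_at-e^_ : (ℕ → ℚ) → Weight → Formal
(f at-e^ β) v =
  ∑ (List.map (λ N → if ⌊ N · β ≟ v ⌋ then f N else 0ℚ) (upTo (suc ∥ v ∥₁)))

log[1-w] : ℕ → ℚ
log[1-w] zero      = 0ℚ
log[1-w] N@(suc _) = ℚ.- (+ 1 / N)

log[1-e^_] : Weight → Formal
log[1-e^ β ] = log[1-w] at-e^ β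

infix 9 _!! _!!≢0

_!! : ℕ → ℕ
zero        !! = 1
suc zero    !! = 1
suc (suc n) !! = suc (suc n) * n !!

_!!≢0 : ∀ n → NonZero (n !!)
zero        !!≢0 = _
suc zero    !!≢0 = _
suc (suc n) !!≢0 = m*n≢0 (suc (suc n)) (n !!) {{_}} {{n !!≢0}}

module _ (K M : ℕ) where

  G-numerator : ℕ
  G-numerator =
    (3 * K + 3 * M) !! * (3 * K) !! * (2 * K) !! * (2 * M) !!

  G-denominator : ℕ
  G-denominator =
    (3 * K + 2 * M) !! * (2 * K + M) !! * (K + M) !!
      * K !! * K !! * M !!

  G-denominator≢0 : NonZero G-denominator
  G-denominator≢0 =
    (3 * K + 2 * M) !!≢0 ⊠ (2 * K + M) !!≢0 ⊠ (K + M) !!≢0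
      ⊠ K !!≢0 ⊠ K !!≢0 ⊠ M !!≢0
    where
    infixl 7 _⊠_
    _⊠_ : ∀ {a b} → NonZero a → NonZero b → NonZero (a * b)
    _⊠_ {a} {b} p q = m*n≢0 a b {{p}} {{q}}

  G : ℚ
  G = (+ 1 / 3) ℚ.* _/_ (+ G-numerator) G-denominator {{G-denominator≢0}}

{-# OPTIONS --safe #-}
module Submission where

-- The prefix times the product over the positive roots is the anti-invariant V in the
-- first identity and d in the second, where V² and d² are up to sign the products over
-- all long and all short roots.  So both sides evaluate ℓ (V^K d^M) up to sign, where
-- ℓ p = CT (p log (1 - e^β)), and it suffices to find recurrences in K and M.
--
-- Although log (1 - e^β) is not invariant under the Weyl group, ℓ kills the divergence
-- of V^K d^M p ∇q for invariant p and q: differentiating the logarithm leaves an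
-- ordinary constant term of y V^K d^M, where the average of y against the sign
-- character of an S₃ in the Weyl group vanishes.  Taking for q the sum s of the short
-- roots or the short product S, such divergences are V^K d^M times polynomials in s
-- and S.  This gives linear relations between the moments ℓ (sⁱ Sʲ V^K d^M), with
-- polynomial coefficients in K and M; solving them determines the moments of S and of
-- the long product D, hence the ratios for M → M + 2 and K → K + 2, which are those of G.

open import Defs
open import Algebra.Bundles using (CommutativeSemiring)
import Algebra.Properties.CommutativeSemigroup as CommutativeSemigroupProperties
import Algebra.Solver.Ring.NaturalCoefficients.Default as SemiringSolver
open import Algebra.Structures using (IsCommutativeMonoid)
open import Algebra.Structures.Biased using (isCommutativeSemiringˡ)
open import Data.Bool.Base using (Bool; true; false; T; _∧_; if_then_else_)
open import Data.Empty using (⊥-elim)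
open import Data.Integer.Base as ℤ using (ℤ; +_; 0ℤ; 1ℤ)
import Data.Integer.Properties as ℤ
import Data.Integer.Solver as ℤ
open import Data.List.Base as List using (List; []; _∷_; _++_; length; cartesianProductWith; applyUpTo; upTo)
open import Data.Nat.Base using (ℕ; zero; suc; _+_; _*_; _≤_; _<_; z<s; s<s; s≤s; NonZero)
import Data.Nat.Properties as ℕ
import Data.Nat.Solver as ℕ
open import Data.Product.Base using (_×_; _,_; proj₁; proj₂; ∃-syntax)
open import Data.Rational.Base as ℚ using (ℚ; 0ℚ; 1ℚ; _/_)
import Data.Rational.Properties as ℚ
open import Data.Rational.Solver using (module +-*-Solver)
import Data.Rational.Unnormalised.Base as ℚᵘ
import Data.Rational.Unnormalised.Properties as ℚᵘ
open import Data.Unit.Base using (tt)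
open import Data.Vec.Base as Vec using (Vec; []; _∷_)
import Data.Vec.Properties as Vec
open import Function.Base using (_∘_; id)
open import Level using (0ℓ)
open import Relation.Binary.PropositionalEquality
import Relation.Binary.Reasoning.Setoid
open import Relation.Nullary.Decidable.Core using (does; yes; no; ⌊_⌋)

open +-*-Solver using (Polynomial; solve; con; _:=_; _:+_; _:*_; _:-_; :-_)

module ℕ+ = CommutativeSemigroupProperties ℕ.+-commutativeSemigroup
module ℕ* = CommutativeSemigroupProperties ℕ.*-commutativeSemigroup
module ℕS = ℕ.+-*-Solver
module ℤS = ℤ.+-*-Solver
module ℤ+ = CommutativeSemigroupProperties ℤ.+-commutativeSemigroup
module ℤ* = CommutativeSemigroupProperties ℤ.*-commutativeSemigroup
module ≃-Reasoning = Relation.Binary.Reasoning.Setoid ℚᵘ.≃-setoid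

private
  variable
    p p′ q q′ r : Laurent
    F H : Formal

-- Laurent polynomials as linear forms

⟦_⟧ : Laurent → Formal → ℚ
⟦ p ⟧ F = ∑ (List.map (λ (c , u) → c ℚ.* F u) p)

⟦⟧-cong : ∀ p → (∀ u → F u ≡ H u) → ⟦ p ⟧ F ≡ ⟦ p ⟧ H
⟦⟧-cong []            e = refl
⟦⟧-cong ((c , u) ∷ p) e = cong₂ ℚ._+_ (cong (c ℚ.*_) (e u)) (⟦⟧-cong p e)

⟦⟧-++ : ∀ p q F → ⟦ p ++ q ⟧ F ≡ ⟦ p ⟧ F ℚ.+ ⟦ q ⟧ F
⟦⟧-++ []      q F = sym (ℚ.+-identityˡ _)
⟦⟧-++ ((c , u) ∷ p) q F = trans (cong (c ℚ.* F u ℚ.+_) (⟦⟧-++ p q F))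
  (sym (ℚ.+-assoc (c ℚ.* F u) (⟦ p ⟧ F) (⟦ q ⟧ F)))

⟦⟧-+ : ∀ p F H → ⟦ p ⟧ (λ u → F u ℚ.+ H u) ≡ ⟦ p ⟧ F ℚ.+ ⟦ p ⟧ H
⟦⟧-+ []            F H = refl
⟦⟧-+ ((c , u) ∷ p) F H = trans (cong (c ℚ.* (F u ℚ.+ H u) ℚ.+_) (⟦⟧-+ p F H))
  (solve 5 (λ c x y z w → c :* (x :+ y) :+ (z :+ w) := (c :* x :+ z) :+ (c :* y :+ w))
    refl c (F u) (H u) (⟦ p ⟧ F) (⟦ p ⟧ H))

⟦⟧-*ˡ : ∀ p a F → ⟦ p ⟧ (λ u → a ℚ.* F u) ≡ a ℚ.* ⟦ p ⟧ F
⟦⟧-*ˡ []            a F = sym (ℚ.*-zeroʳ a)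
⟦⟧-*ˡ ((c , u) ∷ p) a F = trans (cong (c ℚ.* (a ℚ.* F u) ℚ.+_) (⟦⟧-*ˡ p a F))
  (solve 4 (λ a c x z → c :* (a :* x) :+ a :* z := a :* (c :* x :+ z))
    refl a c (F u) (⟦ p ⟧ F))

⟦⟧-0 : ∀ p → ⟦ p ⟧ (λ _ → 0ℚ) ≡ 0ℚ
⟦⟧-0 []            = refl
⟦⟧-0 ((c , u) ∷ p) = cong₂ ℚ._+_ (ℚ.*-zeroʳ c) (⟦⟧-0 p)

⟦⟧-swap : ∀ p q (F : Weight → Formal) →
  ⟦ p ⟧ (λ u → ⟦ q ⟧ (F u)) ≡ ⟦ q ⟧ (λ v → ⟦ p ⟧ (λ u → F u v))
⟦⟧-swap []            q F = sym (⟦⟧-0 q)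
⟦⟧-swap ((c , u) ∷ p) q F = trans
  (cong₂ ℚ._+_ (sym (⟦⟧-*ˡ q c (F u))) (⟦⟧-swap p q F))
  (sym (⟦⟧-+ q _ _))

⟦⟧-map : ∀ (f : ℚ × Weight → ℚ × Weight) (F H : Formal) →
  (∀ c u → proj₁ (f (c , u)) ℚ.* F (proj₂ (f (c , u))) ≡ c ℚ.* H u) →
  ∀ p → ⟦ List.map f p ⟧ F ≡ ⟦ p ⟧ H
⟦⟧-map f F H e []            = refl
⟦⟧-map f F H e ((c , u) ∷ p) = cong₂ ℚ._+_ (e c u) (⟦⟧-map f F H e p)

-- Kept general in `f` so that it serves both the product `⊛` and the gradient pairing `Γ`, which
-- differ only in the scalar attached to a pair of weights.
⟦⟧-cartesianProductWith : ∀ (f : ℚ × Weight → ℚ × Weight → ℚ × Weight) (F : Formal) (H : Weight → Formal) →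
  (∀ c u d v → proj₁ (f (c , u) (d , v)) ℚ.* F (proj₂ (f (c , u) (d , v))) ≡ (c ℚ.* d) ℚ.* H u v) →
  ∀ p q → ⟦ cartesianProductWith f p q ⟧ F ≡ ⟦ p ⟧ (λ u → ⟦ q ⟧ (H u))
⟦⟧-cartesianProductWith f F H e []            q = refl
⟦⟧-cartesianProductWith f F H e ((c , u) ∷ p) q = trans (⟦⟧-++ (List.map (f (c , u)) q) _ F)
  (cong₂ ℚ._+_
    (trans
      (⟦⟧-map (f (c , u)) F (λ v → c ℚ.* H u v)
        (λ d v → trans (e c u d v)
          (solve 3 (λ c d x → (c :* d) :* x := d :* (c :* x)) refl c d (H u v))) q)
      (⟦⟧-*ˡ q c (H u)))
    (⟦⟧-cartesianProductWith f F H e p q))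

⟦⟧-⊛ : ∀ p q F → ⟦ p ⊛ q ⟧ F ≡ ⟦ p ⟧ (λ u → ⟦ q ⟧ (λ v → F (u ⊕ v)))
⟦⟧-⊛ p q F = ⟦⟧-cartesianProductWith _ F (λ u v → F (u ⊕ v)) (λ _ _ _ _ → refl) p q

infix 4 _≈_

-- Lists of terms are not normal forms. Agreeing as linear forms amounts to having equal collected
-- coefficients, without ever collecting them.
record _≈_ (p q : Laurent) : Set where
  constructor mk≈
  field
    at : ∀ F → ⟦ p ⟧ F ≡ ⟦ q ⟧ F

open _≈_

≈-refl : p ≈ p
≈-refl .at F = refl

≈-sym : p ≈ q → q ≈ p
≈-sym e .at F = sym (e .at F)

≈-trans : p ≈ q → q ≈ r → p ≈ r
≈-trans e e′ .at F = trans (e .at F) (e′ .at F)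

++-cong : p ≈ p′ → q ≈ q′ → p ++ q ≈ p′ ++ q′
++-cong {p} {p′} {q} {q′} e e′ .at F = begin
  ⟦ p ++ q ⟧ F             ≡⟨ ⟦⟧-++ p q F ⟩
  ⟦ p ⟧ F ℚ.+ ⟦ q ⟧ F      ≡⟨ cong₂ ℚ._+_ (e .at F) (e′ .at F) ⟩
  ⟦ p′ ⟧ F ℚ.+ ⟦ q′ ⟧ F    ≡⟨ ⟦⟧-++ p′ q′ F ⟨
  ⟦ p′ ++ q′ ⟧ F           ∎
  where open ≡-Reasoning

++-comm : ∀ p q → p ++ q ≈ q ++ p
++-comm p q .at F = trans (⟦⟧-++ p q F) (trans (ℚ.+-comm _ (⟦ q ⟧ F)) (sym (⟦⟧-++ q p F)))

++-assoc : ∀ p q r → (p ++ q) ++ r ≈ p ++ (q ++ r)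
++-assoc p q r .at F = begin
  ⟦ (p ++ q) ++ r ⟧ F                ≡⟨ ⟦⟧-++ (p ++ q) r F ⟩
  ⟦ p ++ q ⟧ F ℚ.+ ⟦ r ⟧ F           ≡⟨ cong (ℚ._+ ⟦ r ⟧ F) (⟦⟧-++ p q F) ⟩
  ⟦ p ⟧ F ℚ.+ ⟦ q ⟧ F ℚ.+ ⟦ r ⟧ F    ≡⟨ ℚ.+-assoc (⟦ p ⟧ F) (⟦ q ⟧ F) (⟦ r ⟧ F) ⟩
  ⟦ p ⟧ F ℚ.+ (⟦ q ⟧ F ℚ.+ ⟦ r ⟧ F)  ≡⟨ cong (⟦ p ⟧ F ℚ.+_) (⟦⟧-++ q r F) ⟨
  ⟦ p ⟧ F ℚ.+ ⟦ q ++ r ⟧ F           ≡⟨ ⟦⟧-++ p (q ++ r) F ⟨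
  ⟦ p ++ (q ++ r) ⟧ F                ∎
  where open ≡-Reasoning

⊕-comm : ∀ u v → u ⊕ v ≡ v ⊕ u
⊕-comm = Vec.zipWith-comm ℤ.+-comm

⊕-assoc : ∀ u v w → (u ⊕ v) ⊕ w ≡ u ⊕ (v ⊕ w)
⊕-assoc = Vec.zipWith-assoc ℤ.+-assoc

⊕-identityˡ : ∀ u → 𝟎 ⊕ u ≡ u
⊕-identityˡ = Vec.zipWith-identityˡ ℤ.+-identityˡ

⊕-inverseˡ : ∀ u → ⊖ u ⊕ u ≡ 𝟎
⊕-inverseˡ = Vec.zipWith-inverseˡ ℤ.+-inverseˡ

⊛-cong : p ≈ p′ → q ≈ q′ → p ⊛ q ≈ p′ ⊛ q′
⊛-cong {p} {p′} {q} {q′} e e′ .at F = begin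
  ⟦ p ⊛ q ⟧ F                              ≡⟨ ⟦⟧-⊛ p q F ⟩
  ⟦ p ⟧ (λ u → ⟦ q ⟧ (λ v → F (u ⊕ v)))    ≡⟨ e .at _ ⟩
  ⟦ p′ ⟧ (λ u → ⟦ q ⟧ (λ v → F (u ⊕ v)))   ≡⟨ ⟦⟧-cong p′ (λ u → e′ .at _) ⟩
  ⟦ p′ ⟧ (λ u → ⟦ q′ ⟧ (λ v → F (u ⊕ v)))  ≡⟨ ⟦⟧-⊛ p′ q′ F ⟨
  ⟦ p′ ⊛ q′ ⟧ F                            ∎
  where open ≡-Reasoning

⊛-comm : ∀ p q → p ⊛ q ≈ q ⊛ p
⊛-comm p q .at F = begin
  ⟦ p ⊛ q ⟧ F                            ≡⟨ ⟦⟧-⊛ p q F ⟩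
  ⟦ p ⟧ (λ u → ⟦ q ⟧ (λ v → F (u ⊕ v)))  ≡⟨ ⟦⟧-swap p q (λ u v → F (u ⊕ v)) ⟩
  ⟦ q ⟧ (λ v → ⟦ p ⟧ (λ u → F (u ⊕ v)))  ≡⟨ ⟦⟧-cong q (λ v → ⟦⟧-cong p (λ u → cong F (⊕-comm u v))) ⟩
  ⟦ q ⟧ (λ v → ⟦ p ⟧ (λ u → F (v ⊕ u)))  ≡⟨ ⟦⟧-⊛ q p F ⟨
  ⟦ q ⊛ p ⟧ F                            ∎
  where open ≡-Reasoning

⊛-assoc : ∀ p q r → (p ⊛ q) ⊛ r ≈ p ⊛ (q ⊛ r)
⊛-assoc p q r .at F = begin
  ⟦ (p ⊛ q) ⊛ r ⟧ F
    ≡⟨ trans (⟦⟧-⊛ (p ⊛ q) r F) (⟦⟧-⊛ p q _) ⟩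
  ⟦ p ⟧ (λ u → ⟦ q ⟧ (λ v → ⟦ r ⟧ (λ w → F ((u ⊕ v) ⊕ w))))
    ≡⟨ ⟦⟧-cong p (λ u → ⟦⟧-cong q (λ v → ⟦⟧-cong r (λ w → cong F (⊕-assoc u v w)))) ⟩
  ⟦ p ⟧ (λ u → ⟦ q ⟧ (λ v → ⟦ r ⟧ (λ w → F (u ⊕ (v ⊕ w)))))
    ≡⟨ ⟦⟧-cong p (λ u → ⟦⟧-⊛ q r _) ⟨
  ⟦ p ⟧ (λ u → ⟦ q ⊛ r ⟧ (λ v → F (u ⊕ v)))
    ≡⟨ ⟦⟧-⊛ p (q ⊛ r) F ⟨
  ⟦ p ⊛ (q ⊛ r) ⟧ F
    ∎
  where open ≡-Reasoning

⊛-identityˡ : ∀ p → one ⊛ p ≈ p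
⊛-identityˡ p .at F = begin
  ⟦ one ⊛ p ⟧ F                           ≡⟨ ⟦⟧-⊛ one p F ⟩
  1ℚ ℚ.* ⟦ p ⟧ (λ u → F (𝟎 ⊕ u)) ℚ.+ 0ℚ   ≡⟨ trans (ℚ.+-identityʳ _) (ℚ.*-identityˡ _) ⟩
  ⟦ p ⟧ (λ u → F (𝟎 ⊕ u))                 ≡⟨ ⟦⟧-cong p (λ u → cong F (⊕-identityˡ u)) ⟩
  ⟦ p ⟧ F                                 ∎
  where open ≡-Reasoning

⊛-distribʳ-++ : ∀ r p q → (p ++ q) ⊛ r ≈ p ⊛ r ++ q ⊛ r
⊛-distribʳ-++ r p q .at F = begin
  ⟦ (p ++ q) ⊛ r ⟧ F             ≡⟨ trans (⟦⟧-⊛ (p ++ q) r F) (⟦⟧-++ p q _) ⟩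
  ⟦ p ⟧ _ ℚ.+ ⟦ q ⟧ _            ≡⟨ cong₂ ℚ._+_ (⟦⟧-⊛ p r F) (⟦⟧-⊛ q r F) ⟨
  ⟦ p ⊛ r ⟧ F ℚ.+ ⟦ q ⊛ r ⟧ F    ≡⟨ ⟦⟧-++ (p ⊛ r) (q ⊛ r) F ⟨
  ⟦ p ⊛ r ++ q ⊛ r ⟧ F           ∎
  where open ≡-Reasoning

-- A semiring is enough for the symbolic rearrangements, since signs enter them as scalars
-- `κ (ℚ.- 1ℚ)`.
laurentSemiring : CommutativeSemiring 0ℓ 0ℓ
laurentSemiring = record
  { _≈_ = _≈_ ; _+_ = _++_ ; _*_ = _⊛_ ; 0# = [] ; 1# = one
  ; isCommutativeSemiring = isCommutativeSemiringˡ record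
    { +-isCommutativeMonoid = commutativeMonoid ++-cong ++-assoc ++-comm (λ p → ≈-refl)
    ; *-isCommutativeMonoid = commutativeMonoid ⊛-cong ⊛-assoc ⊛-comm ⊛-identityˡ
    ; distribʳ = ⊛-distribʳ-++
    ; zeroˡ = λ p → ≈-refl
    }
  }
  where
  commutativeMonoid : ∀ {_✶_ : Laurent → Laurent → Laurent} {ε} →
    (∀ {p p′ q q′} → p ≈ p′ → q ≈ q′ → (p ✶ q) ≈ (p′ ✶ q′)) →
    (∀ p q r → ((p ✶ q) ✶ r) ≈ (p ✶ (q ✶ r))) →
    (∀ p q → (p ✶ q) ≈ (q ✶ p)) → (∀ p → (ε ✶ p) ≈ p) →
    IsCommutativeMonoid _≈_ _✶_ ε
  commutativeMonoid {ε = ε} ✶-cong assoc comm identityˡ = record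
    { isMonoid = record
      { isSemigroup = record
        { isMagma = record
          { isEquivalence = record { refl = ≈-refl ; sym = ≈-sym ; trans = ≈-trans }
          ; ∙-cong = ✶-cong }
        ; assoc = assoc }
      ; identity = identityˡ , λ p → ≈-trans (comm p ε) (identityˡ p) }
    ; comm = comm }

-- Deciding identities between explicit Laurent polynomials

infixl 6 _⊟_
_⊟_ : Laurent → Laurent → Laurent
p ⊟ q = p ++ List.map (λ (c , u) → (ℚ.- c , u)) q

extract : Weight → Laurent → ℚ × Laurent
extract u []            = 0ℚ , []
extract u ((c , v) ∷ p) with extract u p
... | d , r = if does (u ≟ v) then (c ℚ.+ d , r) else (d , (c , v) ∷ r)

-- The number is fuel: `extract` never lengthens a list, so the length of the input suffices.
-- Running out can only make the test fail, so soundness is not at stake.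
isZero : ℕ → Laurent → Bool
isZero _       []            = true
isZero zero    (_ ∷ _)       = false
isZero (suc n) ((c , u) ∷ p) with extract u p
... | d , r = does (c ℚ.+ d ℚ.≟ 0ℚ) ∧ isZero n r

⟦⟧-extract : ∀ u p F → let (d , r) = extract u p in
  ⟦ p ⟧ F ≡ d ℚ.* F u ℚ.+ ⟦ r ⟧ F
⟦⟧-extract u []            F = sym (trans (ℚ.+-identityʳ _) (ℚ.*-zeroˡ (F u)))
⟦⟧-extract u ((c , v) ∷ p) F with extract u p | ⟦⟧-extract u p F
... | d , r | e with u ≟ v
...   | yes refl = trans (cong (c ℚ.* F v ℚ.+_) e)
  (solve 4 (λ c d x y → c :* x :+ (d :* x :+ y) := (c :+ d) :* x :+ y) refl c d (F u) (⟦ r ⟧ F))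
...   | no  _    = trans (cong (c ℚ.* F v ℚ.+_) e)
  (solve 3 (λ x y z → x :+ (y :+ z) := y :+ (x :+ z)) refl (c ℚ.* F v) (d ℚ.* F u) (⟦ r ⟧ F))

isZero-sound : ∀ n p → T (isZero n p) → ∀ F → ⟦ p ⟧ F ≡ 0ℚ
isZero-sound n       []            _ F = refl
isZero-sound (suc n) ((c , u) ∷ p) t F with extract u p | ⟦⟧-extract u p F
... | d , r | e with c ℚ.+ d ℚ.≟ 0ℚ
...   | yes c+d≡0 = begin
  c ℚ.* F u ℚ.+ ⟦ p ⟧ F                    ≡⟨ cong (c ℚ.* F u ℚ.+_) e ⟩
  c ℚ.* F u ℚ.+ (d ℚ.* F u ℚ.+ ⟦ r ⟧ F)    ≡⟨ solve 4
      (λ c d x y → c :* x :+ (d :* x :+ y) := (c :+ d) :* x :+ y) refl c d (F u) (⟦ r ⟧ F) ⟩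
  (c ℚ.+ d) ℚ.* F u ℚ.+ ⟦ r ⟧ F            ≡⟨ cong₂ (λ x y → x ℚ.* F u ℚ.+ y) c+d≡0 (isZero-sound n r t F) ⟩
  0ℚ ℚ.* F u ℚ.+ 0ℚ                        ≡⟨ trans (ℚ.+-identityʳ _) (ℚ.*-zeroˡ (F u)) ⟩
  0ℚ                                       ∎
  where
  open ≡-Reasoning

-- Proof by reflection: on closed Laurent polynomials the test evaluates to `true`, and `tt` is the
-- whole proof. The explicit identities about `s`, `S`, `D`, `V`, `d` are checked in this way.
≈-by-computation : ∀ p q → T (isZero (length (p ⊟ q)) (p ⊟ q)) → p ≈ q
≈-by-computation p q t .at F = begin
  ⟦ p ⟧ F                                  ≡⟨ solve 2 (λ x y → x := (x :- y) :+ y) refl (⟦ p ⟧ F) (⟦ q ⟧ F) ⟩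
  ⟦ p ⟧ F ℚ.- ⟦ q ⟧ F ℚ.+ ⟦ q ⟧ F          ≡⟨ cong (ℚ._+ ⟦ q ⟧ F) (cong (⟦ p ⟧ F ℚ.+_) (⟦⟧-neg q)) ⟨
  ⟦ p ⟧ F ℚ.+ ⟦ [] ⊟ q ⟧ F ℚ.+ ⟦ q ⟧ F     ≡⟨ cong (ℚ._+ ⟦ q ⟧ F)
      (trans (sym (⟦⟧-++ p _ F)) (isZero-sound _ (p ⊟ q) t F)) ⟩
  0ℚ ℚ.+ ⟦ q ⟧ F                           ≡⟨ ℚ.+-identityˡ _ ⟩
  ⟦ q ⟧ F                                  ∎
  where
  open ≡-Reasoning
  ⟦⟧-neg : ∀ q → ⟦ [] ⊟ q ⟧ F ≡ ℚ.- ⟦ q ⟧ F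
  ⟦⟧-neg []            = refl
  ⟦⟧-neg ((c , u) ∷ q) = trans (cong (ℚ.- c ℚ.* F u ℚ.+_) (⟦⟧-neg q))
    (solve 3 (λ c x y → :- c :* x :+ :- y := :- (c :* x :+ y)) refl c (F u) (⟦ q ⟧ F))

-- Integration by parts against the logarithm

ι : ℤ → ℚ
ι z = z / 1

ι-+ : ∀ x y → ι (x ℤ.+ y) ≡ ι x ℚ.+ ι y
ι-+ x y = ℚ.toℚᵘ-injective (begin
  ℚ.toℚᵘ (ι (x ℤ.+ y))               ≈⟨ ℚ.toℚᵘ-fromℚᵘ (ℚᵘ.mkℚᵘ (x ℤ.+ y) 0) ⟩
  ℚᵘ.mkℚᵘ (x ℤ.+ y) 0                ≈⟨ ℚᵘ.*≡* (cong (ℤ._* 1ℤ)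
      (cong₂ ℤ._+_ (sym (ℤ.*-identityʳ x)) (sym (ℤ.*-identityʳ y)))) ⟩
  ℚᵘ.mkℚᵘ x 0 ℚᵘ.+ ℚᵘ.mkℚᵘ y 0       ≈⟨ ℚᵘ.+-cong (ℚ.toℚᵘ-fromℚᵘ (ℚᵘ.mkℚᵘ x 0)) (ℚ.toℚᵘ-fromℚᵘ (ℚᵘ.mkℚᵘ y 0)) ⟨
  ℚ.toℚᵘ (ι x) ℚᵘ.+ ℚ.toℚᵘ (ι y)     ≈⟨ ℚ.toℚᵘ-homo-+ (ι x) (ι y) ⟨
  ℚ.toℚᵘ (ι x ℚ.+ ι y)               ∎)
  where open ≃-Reasoning

ι-* : ∀ x y → ι (x ℤ.* y) ≡ ι x ℚ.* ι y
ι-* x y = ℚ.toℚᵘ-injective (begin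
  ℚ.toℚᵘ (ι (x ℤ.* y))               ≈⟨ ℚ.toℚᵘ-fromℚᵘ (ℚᵘ.mkℚᵘ (x ℤ.* y) 0) ⟩
  ℚᵘ.mkℚᵘ x 0 ℚᵘ.* ℚᵘ.mkℚᵘ y 0       ≈⟨ ℚᵘ.*-cong (ℚ.toℚᵘ-fromℚᵘ (ℚᵘ.mkℚᵘ x 0)) (ℚ.toℚᵘ-fromℚᵘ (ℚᵘ.mkℚᵘ y 0)) ⟨
  ℚ.toℚᵘ (ι x) ℚᵘ.* ℚ.toℚᵘ (ι y)     ≈⟨ ℚ.toℚᵘ-homo-* (ι x) (ι y) ⟨
  ℚ.toℚᵘ (ι x ℚ.* ι y)               ∎)
  where open ≃-Reasoning

ι-*-/ : ∀ n d .{{_ : NonZero d}} → ι (+ d) ℚ.* (n / d) ≡ ι n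
ι-*-/ n (suc d) = ℚ.toℚᵘ-injective (begin
  ℚ.toℚᵘ (ι (+ suc d) ℚ.* (n / suc d))              ≈⟨ ℚ.toℚᵘ-homo-* (ι (+ suc d)) (n / suc d) ⟩
  ℚ.toℚᵘ (ι (+ suc d)) ℚᵘ.* ℚ.toℚᵘ (n / suc d)      ≈⟨ ℚᵘ.*-cong (ℚ.toℚᵘ-fromℚᵘ (ℚᵘ.mkℚᵘ (+ suc d) 0))
      (ℚ.toℚᵘ-fromℚᵘ (ℚᵘ.mkℚᵘ n d)) ⟩
  ℚᵘ.mkℚᵘ (+ suc d) 0 ℚᵘ.* ℚᵘ.mkℚᵘ n d              ≈⟨ ℚᵘ.*≡*
      (trans (ℤ.*-identityʳ _) (trans (ℤ.*-comm (+ suc d) n)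
      (cong (λ m → n ℤ.* + suc m) (sym (ℕ.+-identityʳ d))))) ⟩
  ℚᵘ.mkℚᵘ n 0                                       ≈⟨ ℚ.toℚᵘ-fromℚᵘ (ℚᵘ.mkℚᵘ n 0) ⟨
  ℚ.toℚᵘ (ι n)                                      ∎)
  where open ≃-Reasoning

ι-pos-* : ∀ a b → ι (+ (a * b)) ≡ ι (+ a) ℚ.* ι (+ b)
ι-pos-* a b = trans (cong ι (ℤ.pos-* a b)) (ι-* (+ a) (+ b))

dot : Weight → Weight → ℤ
dot (x ∷ y ∷ z ∷ []) (x′ ∷ y′ ∷ z′ ∷ []) = x ℤ.* x′ ℤ.+ y ℤ.* y′ ℤ.+ z ℤ.* z′

infix 5 _∙_
_∙_ : Weight → Weight → ℚ
u ∙ v = ι (dot u v)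

∙-⊕ʳ : ∀ u v w → (u ∙ v ⊕ w) ≡ (u ∙ v) ℚ.+ (u ∙ w)
∙-⊕ʳ u v w = trans (cong ι (dot-⊕ʳ u v w)) (ι-+ (dot u v) (dot u w))
  where
  dot-⊕ʳ : ∀ u v w → dot u (v ⊕ w) ≡ dot u v ℤ.+ dot u w
  dot-⊕ʳ (x ∷ y ∷ z ∷ []) (x′ ∷ y′ ∷ z′ ∷ []) (x″ ∷ y″ ∷ z″ ∷ [])
    rewrite ℤ.*-distribˡ-+ x x′ x″ | ℤ.*-distribˡ-+ y y′ y″ | ℤ.*-distribˡ-+ z z′ z″
    = trans (cong (ℤ._+ (z ℤ.* z′ ℤ.+ z ℤ.* z″)) (ℤ+.interchange (x ℤ.* x′) (x ℤ.* x″) (y ℤ.* y′) (y ℤ.* y″)))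
        (ℤ+.interchange (x ℤ.* x′ ℤ.+ y ℤ.* y′) (x ℤ.* x″ ℤ.+ y ℤ.* y″) (z ℤ.* z′) (z ℤ.* z″))

∙-·ʳ : ∀ n u v → (u ∙ n · v) ≡ ι (+ n) ℚ.* (u ∙ v)
∙-·ʳ n u v = trans (cong ι (dot-·ʳ (+ n) u v)) (ι-* (+ n) (dot u v))
  where
  dot-·ʳ : ∀ a u v → dot u (Vec.map (a ℤ.*_) v) ≡ a ℤ.* dot u v
  dot-·ʳ a (x ∷ y ∷ z ∷ []) (x′ ∷ y′ ∷ z′ ∷ [])
    rewrite ℤ*.x∙yz≈y∙xz x a x′ | ℤ*.x∙yz≈y∙xz y a y′ | ℤ*.x∙yz≈y∙xz z a z′
    = sym (trans (ℤ.*-distribˡ-+ a (x ℤ.* x′ ℤ.+ y ℤ.* y′) (z ℤ.* z′))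
        (cong (ℤ._+ a ℤ.* (z ℤ.* z′)) (ℤ.*-distribˡ-+ a (x ℤ.* x′) (y ℤ.* y′))))

-- With ∇ the gradient for _∙_, Γ p q = ∇p · ∇q and div (P ∇q) = Δ q ⊛ P ++ Γ q P.
Γ : Laurent → Laurent → Laurent
Γ = cartesianProductWith λ (c , u) (d , v) → (c ℚ.* d ℚ.* (u ∙ v) , u ⊕ v)

Δ : Laurent → Laurent
Δ = List.map λ (c , u) → (c ℚ.* (u ∙ u) , u)

∂ : Weight → Laurent → Laurent
∂ β = List.map λ (c , u) → (c ℚ.* (u ∙ β) , u)

⟦⟧-Γ : ∀ p q F → ⟦ Γ p q ⟧ F ≡ ⟦ p ⟧ (λ u → ⟦ q ⟧ (λ v → (u ∙ v) ℚ.* F (u ⊕ v)))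
⟦⟧-Γ p q F = ⟦⟧-cartesianProductWith _ F _
  (λ c u d v → ℚ.*-assoc (c ℚ.* d) (u ∙ v) (F (u ⊕ v))) p q

Γ-congʳ : q ≈ q′ → Γ p q ≈ Γ p q′
Γ-congʳ {q} {q′} {p} e .at F = begin
  ⟦ Γ p q ⟧ F     ≡⟨ ⟦⟧-Γ p q F ⟩
  ⟦ p ⟧ _         ≡⟨ ⟦⟧-cong p (λ u → e .at _) ⟩
  ⟦ p ⟧ _         ≡⟨ ⟦⟧-Γ p q′ F ⟨
  ⟦ Γ p q′ ⟧ F    ∎
  where open ≡-Reasoning

-- Leibniz rule, from the additivity of `_∙_` in its second argument.
Γ-⊛ : ∀ p q r → Γ p (q ⊛ r) ≈ Γ p q ⊛ r ++ q ⊛ Γ p r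
Γ-⊛ p q r .at F = begin
  ⟦ Γ p (q ⊛ r) ⟧ F
    ≡⟨ ⟦⟧-Γ p (q ⊛ r) F ⟩
  ⟦ p ⟧ (λ u → ⟦ q ⊛ r ⟧ (λ v → (u ∙ v) ℚ.* F (u ⊕ v)))
    ≡⟨ ⟦⟧-cong p (λ u → trans (⟦⟧-⊛ q r _) (trans
         (⟦⟧-cong q (λ v → trans (⟦⟧-cong r (splitWeight u v)) (⟦⟧-+ r _ _)))
         (⟦⟧-+ q _ _))) ⟩
  ⟦ p ⟧ (λ u → left u ℚ.+ right u)
    ≡⟨ ⟦⟧-+ p left right ⟩
  ⟦ p ⟧ left ℚ.+ ⟦ p ⟧ right
    ≡⟨ cong₂ ℚ._+_ left≡ right≡ ⟩
  ⟦ Γ p q ⊛ r ⟧ F ℚ.+ ⟦ q ⊛ Γ p r ⟧ F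
    ≡⟨ ⟦⟧-++ (Γ p q ⊛ r) (q ⊛ Γ p r) F ⟨
  ⟦ Γ p q ⊛ r ++ q ⊛ Γ p r ⟧ F
    ∎
  where
  open ≡-Reasoning
  left right : Formal
  left  u = ⟦ q ⟧ (λ v → ⟦ r ⟧ (λ w → (u ∙ v) ℚ.* F ((u ⊕ v) ⊕ w)))
  right u = ⟦ q ⟧ (λ v → ⟦ r ⟧ (λ w → (u ∙ w) ℚ.* F (v ⊕ (u ⊕ w))))
  splitWeight : ∀ u v w → (u ∙ v ⊕ w) ℚ.* F (u ⊕ (v ⊕ w)) ≡
    (u ∙ v) ℚ.* F ((u ⊕ v) ⊕ w) ℚ.+ (u ∙ w) ℚ.* F (v ⊕ (u ⊕ w))
  splitWeight u v w
    rewrite sym (⊕-assoc v u w) | ⊕-comm v u | ⊕-assoc u v w | ∙-⊕ʳ u v w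
    = ℚ.*-distribʳ-+ (F (u ⊕ (v ⊕ w))) (u ∙ v) (u ∙ w)
  left≡ : ⟦ p ⟧ left ≡ ⟦ Γ p q ⊛ r ⟧ F
  left≡ = sym (trans (⟦⟧-⊛ (Γ p q) r F) (trans (⟦⟧-Γ p q _)
    (⟦⟧-cong p (λ u → ⟦⟧-cong q (λ v → sym (⟦⟧-*ˡ r (u ∙ v) _))))))
  right≡ : ⟦ p ⟧ right ≡ ⟦ q ⊛ Γ p r ⟧ F
  right≡ = trans (⟦⟧-swap p q _) (sym (trans (⟦⟧-⊛ q (Γ p r) F) (⟦⟧-cong q (λ v → ⟦⟧-Γ p r _))))

∑-applyUpTo : ∀ (g : ℕ → ℚ) (k : ℕ → ℕ) {h n} → h < n → (∀ N → N ≢ h → g (k N) ≡ 0ℚ) →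
  ∑ (List.map g (applyUpTo k n)) ≡ g (k h)
∑-applyUpTo g k {zero} {suc n} z<s vanish =
  trans (cong (g (k 0) ℚ.+_) (rest (k ∘ suc) n (λ N → vanish (suc N) λ ()))) (ℚ.+-identityʳ _)
  where
  rest : ∀ (k : ℕ → ℕ) n → (∀ N → g (k N) ≡ 0ℚ) → ∑ (List.map g (applyUpTo k n)) ≡ 0ℚ
  rest k zero    _ = refl
  rest k (suc n) e = cong₂ ℚ._+_ (e 0) (rest (k ∘ suc) n (e ∘ suc))
∑-applyUpTo g k {suc h} {suc n} (s<s h<n) vanish =
  trans (cong₂ ℚ._+_ (vanish 0 λ ()) (∑-applyUpTo g (k ∘ suc) h<n
      (λ N N≢h → vanish (suc N) (N≢h ∘ ℕ.suc-injective))))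
    (ℚ.+-identityˡ _)

-- Minus the Euler derivative of log (1 - w).
w/[1-w] : ℕ → ℚ
w/[1-w] zero    = 0ℚ
w/[1-w] (suc _) = 1ℚ

-- At v = N β the factor N contained in `u ∙ v` cancels the 1/N of the logarithm; at all other v
-- both sides vanish. Hence the derivative of the logarithm in any direction is a multiple of one
-- and the same series.
∙-log : ∀ β u v →
  (u ∙ v) ℚ.* log[1-e^ β ] v ≡ ℚ.- ((u ∙ β) ℚ.* (w/[1-w] at-e^ β) v)
∙-log β u v = sums (upTo (suc ∥ v ∥₁))
  where
  open ≡-Reasoning
  term : (ℕ → ℚ) → ℕ → ℚ
  term f N = if ⌊ N · β ≟ v ⌋ then f N else 0ℚ
  coefficients : ∀ N → (u ∙ N · β) ℚ.* log[1-w] N ≡ ℚ.- ((u ∙ β) ℚ.* w/[1-w] N)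
  coefficients zero = trans (ℚ.*-zeroʳ (u ∙ 0 · β)) (cong ℚ.-_ (sym (ℚ.*-zeroʳ (u ∙ β))))
  coefficients N@(suc _) = begin
    (u ∙ N · β) ℚ.* (ℚ.- (+ 1 / N))
      ≡⟨ cong (ℚ._* (ℚ.- (+ 1 / N))) (∙-·ʳ N u β) ⟩
    ι (+ N) ℚ.* (u ∙ β) ℚ.* (ℚ.- (+ 1 / N))
      ≡⟨ solve 3 (λ n x y → n :* x :* :- y := :- (x :* (n :* y))) refl (ι (+ N)) (u ∙ β) (+ 1 / N) ⟩
    ℚ.- ((u ∙ β) ℚ.* (ι (+ N) ℚ.* (+ 1 / N)))
      ≡⟨ cong (λ x → ℚ.- ((u ∙ β) ℚ.* x)) (ι-*-/ (+ 1) N) ⟩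
    ℚ.- ((u ∙ β) ℚ.* 1ℚ)
      ∎
  terms : ∀ N → (u ∙ v) ℚ.* term log[1-w] N ≡ ℚ.- ((u ∙ β) ℚ.* term w/[1-w] N)
  terms N with N · β ≟ v
  ... | yes refl = coefficients N
  ... | no  _    = trans (ℚ.*-zeroʳ (u ∙ v)) (cong ℚ.-_ (sym (ℚ.*-zeroʳ (u ∙ β))))
  sums : ∀ Ns → (u ∙ v) ℚ.* ∑ (List.map (term log[1-w]) Ns)
              ≡ ℚ.- ((u ∙ β) ℚ.* ∑ (List.map (term w/[1-w]) Ns))
  sums []       = trans (ℚ.*-zeroʳ (u ∙ v)) (cong ℚ.-_ (sym (ℚ.*-zeroʳ (u ∙ β))))
  sums (N ∷ Ns) = begin
    (u ∙ v) ℚ.* (term log[1-w] N ℚ.+ ∑ (List.map (term log[1-w]) Ns))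
      ≡⟨ ℚ.*-distribˡ-+ (u ∙ v) (term log[1-w] N) _ ⟩
    (u ∙ v) ℚ.* term log[1-w] N ℚ.+ (u ∙ v) ℚ.* ∑ (List.map (term log[1-w]) Ns)
      ≡⟨ cong₂ ℚ._+_ (terms N) (sums Ns) ⟩
    ℚ.- ((u ∙ β) ℚ.* term w/[1-w] N) ℚ.+ ℚ.- ((u ∙ β) ℚ.* ∑ (List.map (term w/[1-w]) Ns))
      ≡⟨ solve 3 (λ b x y → :- (b :* x) :+ :- (b :* y) := :- (b :* (x :+ y))) refl
           (u ∙ β) (term w/[1-w] N) (∑ (List.map (term w/[1-w]) Ns)) ⟩
    ℚ.- ((u ∙ β) ℚ.* (term w/[1-w] N ℚ.+ ∑ (List.map (term w/[1-w]) Ns)))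
      ∎

-- As a linear form, `⟦ p ⟧ δ₀` is the constant term of `p`.
δ₀ : Formal
δ₀ u = if ⌊ u ≟ 𝟎 ⌋ then 1ℚ else 0ℚ

0·β≡𝟎 : ∀ β → 0 · β ≡ 𝟎
0·β≡𝟎 (_ ∷ _ ∷ _ ∷ []) = refl

suc-· : ∀ N β → N · β ⊕ β ≡ suc N · β
suc-· N β = zip (+ N) β
  where
  zip : ∀ {n} a (v : Vec ℤ n) → Vec.zipWith ℤ._+_ (Vec.map (a ℤ.*_) v) v ≡ Vec.map ((1ℤ ℤ.+ a) ℤ.*_) v
  zip a []      = refl
  zip a (x ∷ v) = cong₂ _∷_ (trans (ℤ.+-comm (a ℤ.* x) x) (sym (ℤ.suc-* a x))) (zip a v)

⊕-cancelʳ : ∀ u v w → u ⊕ w ≡ v ⊕ w → u ≡ v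
⊕-cancelʳ u v w e = begin
  u              ≡⟨ cancel u ⟨
  u ⊕ w ⊝ w      ≡⟨ cong (_⊝ w) e ⟩
  v ⊕ w ⊝ w      ≡⟨ cancel v ⟩
  v              ∎
  where
  open ≡-Reasoning
  cancel : ∀ u → u ⊕ w ⊝ w ≡ u
  cancel u = trans (⊕-assoc u w (⊖ w)) (trans (cong (u ⊕_) (trans (⊕-comm w (⊖ w)) (⊕-inverseˡ w)))
    (trans (⊕-comm u 𝟎) (⊕-identityˡ u)))

∣head∣ : Weight → ℕ
∣head∣ v = ℤ.∣ Vec.head v ∣

logCT : Weight → Laurent → ℚ
logCT β p = ⟦ p ⟧ (λ u → log[1-e^ β ] (𝟎 ⊝ u))

-- As the first coordinate of β is ±1, the multiple N is read off that of N β.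
module _ (β : Weight) (unit : ∣head∣ β ≡ 1) where

  ∣head∣-· : ∀ N → ∣head∣ (N · β) ≡ N
  ∣head∣-· N = trans (head-· β) (trans (cong (N *_) unit) (ℕ.*-identityʳ N))
    where
    head-· : ∀ v → ∣head∣ (N · v) ≡ N * ∣head∣ v
    head-· (x ∷ _) = ℤ.abs-* (+ N) x

  module _ (f : ℕ → ℚ) where

    at-e^-· : ∀ N → (f at-e^ β) (N · β) ≡ f N
    at-e^-· N = trans (∑-applyUpTo _ id (N<1+∥∥ N) vanish) value
      where
      N<1+∥∥ : ∀ N → N < suc ∥ N · β ∥₁
      N<1+∥∥ N = s≤s (subst (_≤ ∥ N · β ∥₁) (∣head∣-· N) (head≤ (N · β)))
        where
        head≤ : ∀ v → ∣head∣ v ≤ ∥ v ∥₁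
        head≤ (x ∷ v) = ℕ.m≤m+n ℤ.∣ x ∣ _
      vanish : ∀ M → M ≢ N → (if ⌊ M · β ≟ N · β ⌋ then f M else 0ℚ) ≡ 0ℚ
      vanish M M≢N with M · β ≟ N · β
      ... | yes e = ⊥-elim (M≢N (trans (sym (∣head∣-· M)) (trans (cong ∣head∣ e) (∣head∣-· N))))
      ... | no  _ = refl
      value : (if ⌊ N · β ≟ N · β ⌋ then f N else 0ℚ) ≡ f N
      value with N · β ≟ N · β
      ... | yes _ = refl
      ... | no ¬e = ⊥-elim (¬e refl)

    at-e^-vanish : ∀ v → (∀ N → N · β ≡ v → f N ≡ 0ℚ) → (f at-e^ β) v ≡ 0ℚ
    at-e^-vanish v f≡0 = zeros (upTo (suc ∥ v ∥₁))
      where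
      zeros : ∀ Ns → ∑ (List.map (λ N → if ⌊ N · β ≟ v ⌋ then f N else 0ℚ) Ns) ≡ 0ℚ
      zeros []       = refl
      zeros (N ∷ Ns) with N · β ≟ v
      ... | yes e = cong₂ ℚ._+_ (f≡0 N e) (zeros Ns)
      ... | no  _ = trans (ℚ.+-identityˡ _) (zeros Ns)

  private
    E : Formal
    E = w/[1-w] at-e^ β

  -- This is (1 - w) · w/(1 - w) = w read off coefficientwise, at exponents shifted by `β`.
  w/[1-w]-shift : ∀ v → E (v ⊕ β) ≡ δ₀ v ℚ.+ E v
  w/[1-w]-shift v with ∣head∣ v · β ≟ v
  ... | yes e = subst (λ v → E (v ⊕ β) ≡ δ₀ v ℚ.+ E v) e (multiple (∣head∣ v))
    where
    δ₀-· : ∀ N → δ₀ (N · β) ℚ.+ w/[1-w] N ≡ 1ℚ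
    δ₀-· N with N · β ≟ 𝟎
    δ₀-· zero    | yes _ = refl
    δ₀-· zero    | no ¬e = ⊥-elim (¬e (0·β≡𝟎 β))
    δ₀-· (suc N) | yes e with () ← trans (sym (∣head∣-· (suc N))) (cong ∣head∣ e)
    δ₀-· (suc N) | no  _ = refl
    multiple : ∀ N → E (N · β ⊕ β) ≡ δ₀ (N · β) ℚ.+ E (N · β)
    multiple N = begin
      E (N · β ⊕ β)                 ≡⟨ cong E (suc-· N β) ⟩
      E (suc N · β)                 ≡⟨ at-e^-· w/[1-w] (suc N) ⟩
      1ℚ                            ≡⟨ δ₀-· N ⟨
      δ₀ (N · β) ℚ.+ w/[1-w] N      ≡⟨ cong (δ₀ (N · β) ℚ.+_) (at-e^-· w/[1-w] N) ⟨
      δ₀ (N · β) ℚ.+ E (N · β)      ∎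
      where open ≡-Reasoning
  ... | no ¬e = trans lhs (sym (cong₂ ℚ._+_ δ₀v≡0 (at-e^-vanish w/[1-w] v λ N e → ⊥-elim (∉ N e))))
    where
    ∉ : ∀ N → N · β ≢ v
    ∉ N e = ¬e (trans (cong (_· β) (trans (cong ∣head∣ (sym e)) (∣head∣-· N))) e)
    δ₀v≡0 : δ₀ v ≡ 0ℚ
    δ₀v≡0 with v ≟ 𝟎
    ... | yes e = ⊥-elim (∉ 0 (trans (0·β≡𝟎 β) (sym e)))
    ... | no  _ = refl
    lhs : E (v ⊕ β) ≡ 0ℚ
    lhs = at-e^-vanish w/[1-w] (v ⊕ β) λ where
      zero    _ → refl
      (suc N) e → ⊥-elim (∉ N (⊕-cancelʳ (N · β) v β (trans (suc-· N β) e)))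

  E-reflected : ∀ w → E (𝟎 ⊝ w) ≡ δ₀ (β ⊕ w) ℚ.+ E (𝟎 ⊝ (β ⊕ w))
  E-reflected w = begin
    E (𝟎 ⊝ w)                                        ≡⟨ cong E (shifted β w) ⟩
    E (𝟎 ⊝ (β ⊕ w) ⊕ β)                              ≡⟨ w/[1-w]-shift (𝟎 ⊝ (β ⊕ w)) ⟩
    δ₀ (𝟎 ⊝ (β ⊕ w)) ℚ.+ E (𝟎 ⊝ (β ⊕ w))             ≡⟨ cong (ℚ._+ E (𝟎 ⊝ (β ⊕ w))) (δ₀-⊝ (β ⊕ w)) ⟩
    δ₀ (β ⊕ w) ℚ.+ E (𝟎 ⊝ (β ⊕ w))                   ∎
    where
    open ≡-Reasoning
    shift : ∀ x y → 0ℤ ℤ.+ ℤ.- y ≡ 0ℤ ℤ.+ ℤ.- (x ℤ.+ y) ℤ.+ x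
    shift = ℤS.solve 2 (λ x y → ℤS.con 0ℤ ℤS.:+ ℤS.:- y ℤS.:= ℤS.con 0ℤ ℤS.:+ ℤS.:- (x ℤS.:+ y) ℤS.:+ x) refl
    shifted : ∀ β w → 𝟎 ⊝ w ≡ 𝟎 ⊝ (β ⊕ w) ⊕ β
    shifted (x ∷ y ∷ z ∷ []) (x′ ∷ y′ ∷ z′ ∷ []) =
      cong₂ _∷_ (shift x x′) (cong₂ _∷_ (shift y y′) (cong₂ _∷_ (shift z z′) refl))
    δ₀-⊝ : ∀ u → δ₀ (𝟎 ⊝ u) ≡ δ₀ u
    δ₀-⊝ u with 𝟎 ⊝ u ≟ 𝟎 | u ≟ 𝟎
    ... | yes _  | yes _ = refl
    ... | no  _  | no  _ = refl
    ... | no ¬e  | yes e = ⊥-elim (¬e (cong (𝟎 ⊝_) e))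
    ... | yes e  | no ¬e = ⊥-elim (¬e (trans (sym (⊕-identityˡ u))
        (trans (cong (_⊕ u) (trans (sym e) (⊕-identityˡ (⊖ u)))) (⊕-inverseˡ u))))

  -- Up to sign, w / (1 - w) is what the derivative leaves of the logarithm; the factor
  -- 1 - w of ∂ β q ⊛ P then telescopes the sum over N to its first term.
  integrationByParts : ∀ q P h → ∂ β q ⊛ P ≈ 1-e^ β ⊛ h →
    logCT β (Δ q ⊛ P ++ Γ q P) ≡ ⟦ e^ β ⊛ h ⟧ δ₀
  integrationByParts q P h ∂qP≈ = begin
    logCT β (Δ q ⊛ P ++ Γ q P)
      ≡⟨ trans (⟦⟧-++ (Δ q ⊛ P) (Γ q P) L) (cong₂ ℚ._+_
           (trans (⟦⟧-⊛ (Δ q) P L) (trans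
             (⟦⟧-map _ _ (λ u → (u ∙ u) ℚ.* ⟦ P ⟧ (λ v → L (u ⊕ v))) (λ c u → ℚ.*-assoc c _ _) q)
             (⟦⟧-cong q (λ u → sym (⟦⟧-*ˡ P (u ∙ u) _)))))
           (⟦⟧-Γ q P L)) ⟩
    ⟦ q ⟧ (λ u → ⟦ P ⟧ (λ v → (u ∙ u) ℚ.* L (u ⊕ v))) ℚ.+ ⟦ q ⟧ (λ u → ⟦ P ⟧ (λ v → (u ∙ v) ℚ.* L (u ⊕ v)))
      ≡⟨ ⟦⟧-+ q _ _ ⟨
    ⟦ q ⟧ (λ u → ⟦ P ⟧ (λ v → (u ∙ u) ℚ.* L (u ⊕ v)) ℚ.+ ⟦ P ⟧ (λ v → (u ∙ v) ℚ.* L (u ⊕ v)))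
      ≡⟨ ⟦⟧-cong q (λ u → trans (sym (⟦⟧-+ P _ _)) (trans (⟦⟧-cong P (collect u)) (⟦⟧-*ˡ P (u ∙ β) _))) ⟩
    ⟦ q ⟧ (λ u → (u ∙ β) ℚ.* ⟦ P ⟧ (λ v → E⁻ (u ⊕ v)))
      ≡⟨ ⟦⟧-map _ _ _ (λ c u → ℚ.*-assoc c _ _) q ⟨
    ⟦ ∂ β q ⟧ (λ u → ⟦ P ⟧ (λ v → E⁻ (u ⊕ v)))
      ≡⟨ ⟦⟧-⊛ (∂ β q) P E⁻ ⟨
    ⟦ ∂ β q ⊛ P ⟧ E⁻
      ≡⟨ ∂qP≈ .at E⁻ ⟩
    ⟦ 1-e^ β ⊛ h ⟧ E⁻
      ≡⟨ ⟦⟧-⊛ (1-e^ β) h E⁻ ⟩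
    1ℚ ℚ.* ⟦ h ⟧ (λ w → E⁻ (𝟎 ⊕ w)) ℚ.+ ((ℚ.- 1ℚ) ℚ.* ⟦ h ⟧ (λ w → E⁻ (β ⊕ w)) ℚ.+ 0ℚ)
      ≡⟨ cong (λ x → 1ℚ ℚ.* x ℚ.+ ((ℚ.- 1ℚ) ℚ.* ⟦ h ⟧ (λ w → E⁻ (β ⊕ w)) ℚ.+ 0ℚ))
          (trans (⟦⟧-cong h (λ w → trans (cong E⁻ (⊕-identityˡ w)) (E-reflected w))) (⟦⟧-+ h _ _)) ⟩
    1ℚ ℚ.* (⟦ h ⟧ (λ w → δ₀ (β ⊕ w)) ℚ.+ ⟦ h ⟧ (λ w → E⁻ (β ⊕ w))) ℚ.+
        ((ℚ.- 1ℚ) ℚ.* ⟦ h ⟧ (λ w → E⁻ (β ⊕ w)) ℚ.+ 0ℚ)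
      ≡⟨ solve 2 (λ x y → con 1ℚ :* (x :+ y) :+ (:- con 1ℚ :* y :+ con 0ℚ) := con 1ℚ :* x :+ con 0ℚ) refl
          (⟦ h ⟧ (λ w → δ₀ (β ⊕ w))) (⟦ h ⟧ (λ w → E⁻ (β ⊕ w))) ⟩
    1ℚ ℚ.* ⟦ h ⟧ (λ w → δ₀ (β ⊕ w)) ℚ.+ 0ℚ
      ≡⟨ ⟦⟧-⊛ (e^ β) h δ₀ ⟨
    ⟦ e^ β ⊛ h ⟧ δ₀
      ∎
    where
    open ≡-Reasoning
    L E⁻ : Formal
    L  u = log[1-e^ β ] (𝟎 ⊝ u)
    E⁻ u = E (𝟎 ⊝ u)
    ∙-reflect : ∀ u w → (u ∙ w) ≡ ℚ.- (u ∙ 𝟎 ⊝ w)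
    ∙-reflect u w = begin
      (u ∙ w)
        ≡⟨ solve 2 (λ x y → x := (y :+ x) :- y) refl (u ∙ w) (u ∙ 𝟎 ⊝ w) ⟩
      (u ∙ 𝟎 ⊝ w) ℚ.+ (u ∙ w) ℚ.- (u ∙ 𝟎 ⊝ w)
        ≡⟨ cong (ℚ._- (u ∙ 𝟎 ⊝ w)) (∙-⊕ʳ u (𝟎 ⊝ w) w) ⟨
      (u ∙ 𝟎 ⊝ w ⊕ w) ℚ.- (u ∙ 𝟎 ⊝ w)
        ≡⟨ cong (λ v → (u ∙ v) ℚ.- (u ∙ 𝟎 ⊝ w)) (trans (cong (_⊕ w) (⊕-identityˡ (⊖ w))) (⊕-inverseˡ w)) ⟩
      (u ∙ 𝟎) ℚ.- (u ∙ 𝟎 ⊝ w)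
        ≡⟨ cong (ℚ._- (u ∙ 𝟎 ⊝ w)) (∙-𝟎 u) ⟩
      0ℚ ℚ.- (u ∙ 𝟎 ⊝ w)
        ≡⟨ ℚ.+-identityˡ _ ⟩
      ℚ.- (u ∙ 𝟎 ⊝ w)
        ∎
      where
      ∙-𝟎 : ∀ u → (u ∙ 𝟎) ≡ 0ℚ
      ∙-𝟎 u = trans (cong (u ∙_) (sym (0·β≡𝟎 u))) (trans (∙-·ʳ 0 u u) (ℚ.*-zeroˡ (u ∙ u)))
    -- The Laplacian and gradient terms add up to the pairing of `u` with the total exponent
    -- `u ⊕ v`. Up to sign, that is the exponent at which the logarithm is read, so `∙-log` applies.
    collect : ∀ u v → (u ∙ u) ℚ.* L (u ⊕ v) ℚ.+ (u ∙ v) ℚ.* L (u ⊕ v) ≡ (u ∙ β) ℚ.* E⁻ (u ⊕ v)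
    collect u v = begin
      (u ∙ u) ℚ.* L w ℚ.+ (u ∙ v) ℚ.* L w       ≡⟨ ℚ.*-distribʳ-+ (L w) (u ∙ u) (u ∙ v) ⟨
      ((u ∙ u) ℚ.+ (u ∙ v)) ℚ.* L w             ≡⟨ cong (ℚ._* L w) (∙-⊕ʳ u u v) ⟨
      (u ∙ w) ℚ.* L w                             ≡⟨ cong (ℚ._* L w) (∙-reflect u w) ⟩
      (ℚ.- (u ∙ 𝟎 ⊝ w)) ℚ.* L w                   ≡⟨ ℚ.neg-distribˡ-* (u ∙ 𝟎 ⊝ w) (L w) ⟨
      ℚ.- ((u ∙ 𝟎 ⊝ w) ℚ.* L w)                   ≡⟨ cong ℚ.-_ (∙-log β u (𝟎 ⊝ w)) ⟩
      ℚ.- (ℚ.- ((u ∙ β) ℚ.* E⁻ w))                ≡⟨ solve 1 (λ x → :- (:- x) := x) refl ((u ∙ β) ℚ.* E⁻ w) ⟩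
      (u ∙ β) ℚ.* E⁻ w                            ∎
      where
      w : Weight
      w = u ⊕ v

ι-*-1/ : ∀ n x → ι (+ suc n) ℚ.* ((+ 1 / suc n) ℚ.* x) ≡ x
ι-*-1/ n x = trans (sym (ℚ.*-assoc (ι (+ suc n)) (+ 1 / suc n) x))
  (trans (cong (ℚ._* x) (ι-*-/ (+ 1) (suc n))) (ℚ.*-identityˡ x))

ι-*-cancelˡ : ∀ n x y → ι (+ suc n) ℚ.* x ≡ ι (+ suc n) ℚ.* y → x ≡ y
ι-*-cancelˡ n x y e = begin
  x                                          ≡⟨ ι-*-1/ n x ⟨
  ι (+ suc n) ℚ.* ((+ 1 / suc n) ℚ.* x)      ≡⟨ swap x ⟩
  (+ 1 / suc n) ℚ.* (ι (+ suc n) ℚ.* x)      ≡⟨ cong ((+ 1 / suc n) ℚ.*_) e ⟩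
  (+ 1 / suc n) ℚ.* (ι (+ suc n) ℚ.* y)      ≡⟨ swap y ⟨
  ι (+ suc n) ℚ.* ((+ 1 / suc n) ℚ.* y)      ≡⟨ ι-*-1/ n y ⟩
  y                                          ∎
  where
  open ≡-Reasoning
  swap : ∀ x → ι (+ suc n) ℚ.* ((+ 1 / suc n) ℚ.* x) ≡ (+ 1 / suc n) ℚ.* (ι (+ suc n) ℚ.* x)
  swap x = solve 3 (λ a b x → a :* (b :* x) := b :* (a :* x)) refl (ι (+ suc n)) (+ 1 / suc n) x

-- Solving the relations between the moments

-- The names ending in ᵖ are the ring solver's syntax for the functions without it.
# : ∀ {n} → ℕ → Polynomial n
# a = con (ι (+ a))

-# : ∀ {n} → ℕ → Polynomial n
-# a = con (ℚ.- ι (+ a))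

linear : ℕ → ℕ → ℕ → ℚ → ℚ → ℚ
linear a b c K M = ι (+ a) ℚ.* K ℚ.+ ι (+ b) ℚ.* M ℚ.+ ι (+ c)

linearᵖ : ∀ {n} → ℕ → ℕ → ℕ → Polynomial n → Polynomial n → Polynomial n
linearᵖ a b c K M = # a :* K :+ # b :* M :+ # c

ι-linear : ∀ a b c k m → linear a b c (ι (+ k)) (ι (+ m)) ≡ ι (+ (a * k + b * m + c))
ι-linear a b c k m = sym (begin
  ι (+ (a * k + b * m + c))                          ≡⟨ ι-+ (+ (a * k + b * m)) (+ c) ⟩
  ι (+ (a * k + b * m)) ℚ.+ ι (+ c)                  ≡⟨ cong (ℚ._+ ι (+ c)) (ι-+ (+ (a * k)) (+ (b * m))) ⟩
  ι (+ (a * k)) ℚ.+ ι (+ (b * m)) ℚ.+ ι (+ c)        ≡⟨ cong₂ (λ x y → x ℚ.+ y ℚ.+ ι (+ c)) (ι-pos-* a k)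
      (ι-pos-* b m) ⟩
  linear a b c (ι (+ k)) (ι (+ m))                   ∎)
  where open ≡-Reasoning

-- Below μₙ is the functional ℓ at sⁿ A, νₙ at sⁿ S A and ωₙ at sⁿ S² A, where A behaves
-- like V^K d^M.  sRelation n is ℓ at the divergence of sⁿ A ∇s, SRelation that of A ∇S.
sRelation₀ : (K M μ₀ μ₁ : ℚ) → ℚ
sRelation₀ K M μ₀ μ₁ = ι (+ 2) ℚ.* μ₁ ℚ.+ (K ℚ.* (ι (+ 3) ℚ.* μ₁) ℚ.+ M ℚ.* (ι (+ 2) ℚ.* μ₁ ℚ.+ ι (+ 6) ℚ.* μ₀))

-- Here `μ₀`, `μ₁`, `μ₂` stand for the moments of orders n - 1, n, n + 1 and `ν₀` for that of order
-- n - 1, which is why order 0 has its own form. The terms multiplied by n come from |∇s|², expanded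
-- in `Γₛₛ`.
sRelation : ℕ → (K M μ₀ μ₁ μ₂ ν₀ : ℚ) → ℚ
sRelation n K M μ₀ μ₁ μ₂ ν₀ = ι (+ 2) ℚ.* μ₂
  ℚ.+ (ι (+ n) ℚ.* (+ 3 / 2 ℚ.* μ₂ ℚ.+ (ℚ.- (+ 1 / 2) ℚ.* ν₀ ℚ.+
      ((ℚ.- ι (+ 6)) ℚ.* μ₁ ℚ.+ (ℚ.- ι (+ 18)) ℚ.* μ₀)))
  ℚ.+ (K ℚ.* (ι (+ 3) ℚ.* μ₂) ℚ.+ M ℚ.* (ι (+ 2) ℚ.* μ₂ ℚ.+ ι (+ 6) ℚ.* μ₁)))

SRelation : (K M μ₀ μ₁ μ₂ ν₀ : ℚ) → ℚ
SRelation K M μ₀ μ₁ μ₂ ν₀ = (ℚ.- ι (+ 36)) ℚ.* μ₀ ℚ.+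
    (ι (+ 7) ℚ.* ν₀ ℚ.+ (ι (+ 12) ℚ.* μ₁ ℚ.+ (ℚ.- ι (+ 1)) ℚ.* μ₂))
  ℚ.+ (K ℚ.* (ι (+ 6) ℚ.* ν₀)
  ℚ.+ M ℚ.* ((ℚ.- ι (+ 36)) ℚ.* μ₀ ℚ.+ (ι (+ 3) ℚ.* ν₀ ℚ.+ (ι (+ 12) ℚ.* μ₁ ℚ.+ (ℚ.- ι (+ 1)) ℚ.* μ₂))))

sRelation₀ᵖ : ∀ {n} → (K M μ₀ μ₁ : Polynomial n) → Polynomial n
sRelation₀ᵖ K M μ₀ μ₁ = # 2 :* μ₁ :+ (K :* (# 3 :* μ₁) :+ M :* (# 2 :* μ₁ :+ # 6 :* μ₀))

sRelationᵖ : ∀ {n} → ℕ → (K M μ₀ μ₁ μ₂ ν₀ : Polynomial n) → Polynomial n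
sRelationᵖ n K M μ₀ μ₁ μ₂ ν₀ = # 2 :* μ₂
  :+ (# n :* (con (+ 3 / 2) :* μ₂ :+ (con (ℚ.- (+ 1 / 2)) :* ν₀ :+ (-# 6 :* μ₁ :+ -# 18 :* μ₀)))
  :+ (K :* (# 3 :* μ₂) :+ M :* (# 2 :* μ₂ :+ # 6 :* μ₁)))

SRelationᵖ : ∀ {n} → (K M μ₀ μ₁ μ₂ ν₀ : Polynomial n) → Polynomial n
SRelationᵖ K M μ₀ μ₁ μ₂ ν₀ = -# 36 :* μ₀ :+ (# 7 :* ν₀ :+ (# 12 :* μ₁ :+ -# 1 :* μ₂))
  :+ (K :* (# 6 :* ν₀)
  :+ M :* (-# 36 :* μ₀ :+ (# 3 :* ν₀ :+ (# 12 :* μ₁ :+ -# 1 :* μ₂))))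

-- A linear-combination step: the ring solver supplies the first equation, `e` is an expression that
-- some relation makes zero, and `c` is the multiplier of that relation.
modulo : ∀ x y c e → x ≡ y ℚ.+ c ℚ.* e → e ≡ 0ℚ → x ≡ y
modulo x y c e x≡ refl = trans x≡ (trans (cong (y ℚ.+_) (ℚ.*-zeroʳ c)) (ℚ.+-identityʳ y))

-- Together with `Divisible`, this is all that the elimination uses about K and M beyond the ring
-- laws. It holds at naturals because the form then has a positive value. The constant term is c +
-- 1, so `cancel 3 2 1` removes 3K + 2M + 2.
Cancellative : ℚ → ℚ → Set
Cancellative K M = ∀ a b c {x y} →
  linear a b (suc c) K M ℚ.* x ≡ linear a b (suc c) K M ℚ.* y → x ≡ y

Divisible : ℚ → ℚ → Set
Divisible K M = ∀ a b c x → ∃[ y ] linear a b (suc c) K M ℚ.* y ≡ x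

module _ (k m : ℕ) where

  private
    linear≡ : ∀ a b c → linear a b (suc c) (ι (+ k)) (ι (+ m)) ≡ ι (+ suc (a * k + b * m + c))
    linear≡ a b c = trans (ι-linear a b (suc c) k m) (cong (λ n → ι (+ n)) (ℕ.+-suc (a * k + b * m) c))

  linear-cancel : Cancellative (ι (+ k)) (ι (+ m))
  linear-cancel a b c {x} {y} e = ι-*-cancelˡ (a * k + b * m + c) x y
    (subst (λ l → l ℚ.* x ≡ l ℚ.* y) (linear≡ a b c) e)

  linear-divides : Divisible (ι (+ k)) (ι (+ m))
  linear-divides a b c x = y ,
    trans (cong (ℚ._* y) (linear≡ a b c)) (ι-*-1/ (a * k + b * m + c) x)
    where
    y : ℚ
    y = (+ 1 / suc (a * k + b * m + c)) ℚ.* x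

solve-μ₁ : ∀ K M → Cancellative K M → ∀ w {μ₀ μ₁} → μ₀ ≡ linear 3 2 2 K M ℚ.* w →
  sRelation₀ K M μ₀ μ₁ ≡ 0ℚ → μ₁ ≡ (ℚ.- ι (+ 6)) ℚ.* M ℚ.* w
solve-μ₁ K M cancel w {μ₁ = μ₁} refl e = cancel 3 2 1 (modulo _ _ 1ℚ _
  (solve 4 (λ K M w μ₁ → linearᵖ 3 2 2 K M :* μ₁
     := linearᵖ 3 2 2 K M :* (-# 6 :* M :* w) :+ con 1ℚ :* sRelation₀ᵖ K M (linearᵖ 3 2 2 K M :* w) μ₁)
    refl K M w μ₁) e)

quadratic : (K M w : ℚ) → ℚ
quadratic K M w = linear 3 2 4 K M ℚ.* (linear 2 1 2 K M ℚ.* w)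

quadraticᵖ : ∀ {n} → (K M w : Polynomial n) → Polynomial n
quadraticᵖ K M w = linearᵖ 3 2 4 K M :* (linearᵖ 2 1 2 K M :* w)

-- Numerators in the solution of the moment relations as a linear system over ℚ (K , M).
P₂ : ℚ → ℚ → ℚ
P₂ K M = ι (+ 12) ℚ.* ((ι (+ 9) ℚ.* K ℚ.+ ((ι (+ 6) ℚ.* M ℚ.+ ι (+ 6)) ℚ.* M ℚ.+ ι (+ 18))) ℚ.* K
   ℚ.+ (((ι (+ 3) ℚ.* M ℚ.+ ι (+ 9)) ℚ.* M ℚ.+ ι (+ 6)) ℚ.* M ℚ.+ ι (+ 8)))

P₂ᵖ : ∀ {n} → (K M : Polynomial n) → Polynomial n
P₂ᵖ K M = # 12 :* ((# 9 :* K :+ ((# 6 :* M :+ # 6) :* M :+ # 18)) :* K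
   :+ (((# 3 :* M :+ # 9) :* M :+ # 6) :* M :+ # 8))

P₃ : ℚ → ℚ → ℚ
P₃ K M = ι (+ 72) ℚ.* ((((ℚ.- ι (+ 27)) ℚ.* M ℚ.+ ι (+ 18)) ℚ.* K
   ℚ.+ ((((ℚ.- ι (+ 6)) ℚ.* M ℚ.+ (ℚ.- ι (+ 18))) ℚ.* M ℚ.+ (ℚ.- ι (+ 66))) ℚ.* M ℚ.+ ι (+ 36))) ℚ.* K
   ℚ.+ (((((ℚ.- ι (+ 3)) ℚ.* M ℚ.+ (ℚ.- ι (+ 15))) ℚ.* M ℚ.+ (ℚ.- ι (+ 24))) ℚ.* M ℚ.+ (ℚ.- ι (+ 36)))
       ℚ.* M ℚ.+ ι (+ 16)))

P₃ᵖ : ∀ {n} → (K M : Polynomial n) → Polynomial n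
P₃ᵖ K M = # 72 :* (((-# 27 :* M :+ # 18) :* K
   :+ (((-# 6 :* M :+ -# 18) :* M :+ -# 66) :* M :+ # 36)) :* K
   :+ ((((-# 3 :* M :+ -# 15) :* M :+ -# 24) :* M :+ -# 36) :* M :+ # 16))

P₄ : ℚ → ℚ → ℚ
P₄ K M = ι (+ 432) ℚ.* ((((ι (+ 81) ℚ.* K
   ℚ.+ ((ι (+ 108) ℚ.* M ℚ.+ (ℚ.- ι (+ 36))) ℚ.* M ℚ.+ ι (+ 648))) ℚ.* K
   ℚ.+ ((((ι (+ 12) ℚ.* M ℚ.+ ι (+ 126)) ℚ.* M ℚ.+ ι (+ 546)) ℚ.* M ℚ.+ (ℚ.- ι (+ 72))) ℚ.* M ℚ.+ ι
       (+ 1764))) ℚ.* K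
   ℚ.+ (((((ι (+ 12) ℚ.* M ℚ.+ ι (+ 108)) ℚ.* M ℚ.+ ι (+ 456)) ℚ.* M ℚ.+ ι (+ 960)) ℚ.* M ℚ.+ ι (+ 40))
       ℚ.* M ℚ.+ ι (+ 1872))) ℚ.* K
   ℚ.+ ((((((ι (+ 3) ℚ.* M ℚ.+ ι (+ 36)) ℚ.* M ℚ.+ ι (+ 165)) ℚ.* M ℚ.+ ι (+ 408)) ℚ.* M ℚ.+ ι (+ 548))
       ℚ.* M ℚ.+ ι (+ 80)) ℚ.* M ℚ.+ ι (+ 640)))

P₄ᵖ : ∀ {n} → (K M : Polynomial n) → Polynomial n
P₄ᵖ K M = # 432 :* ((((# 81 :* K
   :+ ((# 108 :* M :+ -# 36) :* M :+ # 648)) :* K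
   :+ ((((# 12 :* M :+ # 126) :* M :+ # 546) :* M :+ -# 72) :* M :+ # 1764)) :* K
   :+ (((((# 12 :* M :+ # 108) :* M :+ # 456) :* M :+ # 960) :* M :+ # 40) :* M :+ # 1872)) :* K
   :+ ((((((# 3 :* M :+ # 36) :* M :+ # 165) :* M :+ # 408) :* M :+ # 548) :* M :+ # 80) :* M :+ # 640))

-- The values of μ₀, μ₁ and ν₀ in terms of `w`. The factors of `leading₀` clear the denominators of
-- the moments up to μ₂, and `leading₂` over `leading₀` is `M-numerator` over `M-denominator`.
leading₀ leading₁ leading₂ : (K M w : ℚ) → ℚ
leading₀ K M w = linear 3 2 2 K M ℚ.* quadratic K M w
leading₁ K M w = (ℚ.- ι (+ 6)) ℚ.* M ℚ.* quadratic K M w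
leading₂ K M w = ι (+ 6) ℚ.* (linear 3 3 2 K M ℚ.* (linear 3 3 4 K M ℚ.* (linear 0 2 2 K M ℚ.* w)))

leading₀ᵖ leading₁ᵖ leading₂ᵖ : ∀ {n} → (K M w : Polynomial n) → Polynomial n
leading₀ᵖ K M w = linearᵖ 3 2 2 K M :* quadraticᵖ K M w
leading₁ᵖ K M w = -# 6 :* M :* quadraticᵖ K M w
leading₂ᵖ K M w = # 6 :* (linearᵖ 3 3 2 K M :* (linearᵖ 3 3 4 K M :* (linearᵖ 0 2 2 K M :* w)))

module _ (K M : ℚ) (cancel : Cancellative K M) (w : ℚ) {μ₀ μ₁ μ₂ ν₀ : ℚ} where

  -- Eliminates μ₂. Its coefficients in the two relations are 3K + 2M + 7/2 and -(1 + M); the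
  -- multipliers are these, exchanged and with the sign adjusted. The coefficient of ν₀ becomes (9K
  -- + 6M + 12)(2K + M + 2), whence the two cancellations.
  solve-ν₀ : μ₀ ≡ leading₀ K M w → μ₁ ≡ leading₁ K M w →
    sRelation 1 K M μ₀ μ₁ μ₂ ν₀ ≡ 0ℚ → SRelation K M μ₀ μ₁ μ₂ ν₀ ≡ 0ℚ → ν₀ ≡ leading₂ K M w
  solve-ν₀ refl refl eS eT = cancel 2 1 1 (cancel 9 6 11
    (modulo _ _ (1ℚ ℚ.+ M) _ (modulo _ _ (ι (+ 3) ℚ.* K ℚ.+ ι (+ 2) ℚ.* M ℚ.+ (+ 7 / 2)) _
      (solve 5 (λ K M w μ₂ ν₀ →
        linearᵖ 9 6 12 K M :* (linearᵖ 2 1 2 K M :* ν₀)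
        := linearᵖ 9 6 12 K M :* (linearᵖ 2 1 2 K M :* leading₂ᵖ K M w)
        :+ (con 1ℚ :+ M) :* sRelationᵖ 1 K M (leading₀ᵖ K M w) (leading₁ᵖ K M w) μ₂ ν₀
        :+ (# 3 :* K :+ # 2 :* M :+ con (+ 7 / 2)) :* SRelationᵖ K M (leading₀ᵖ K M w) (leading₁ᵖ K M w) μ₂ ν₀)
        refl K M w μ₂ ν₀) eT) eS))

  solve-μ₂ : μ₀ ≡ leading₀ K M w → μ₁ ≡ leading₁ K M w → ν₀ ≡ leading₂ K M w →
    sRelation 1 K M μ₀ μ₁ μ₂ ν₀ ≡ 0ℚ → μ₂ ≡ P₂ K M ℚ.* w
  solve-μ₂ refl refl refl eS = cancel 6 4 6 (modulo _ _ (ι (+ 2)) _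
    (solve 4 (λ K M w μ₂ →
      linearᵖ 6 4 7 K M :* μ₂ := linearᵖ 6 4 7 K M :* (P₂ᵖ K M :* w)
        :+ # 2 :* sRelationᵖ 1 K M (leading₀ᵖ K M w) (leading₁ᵖ K M w) μ₂ (leading₂ᵖ K M w))
      refl K M w μ₂) eS)

-- The ratios G (K , M + 2) / G (K , M) and G (K + 2 , M) / G (K , M).
M-numerator M-denominator K-numerator K-denominator : (K M : ℚ) → ℚ
M-numerator   K M = ι (+ 6) ℚ.* (linear 3 3 4 K M ℚ.* linear 3 3 2 K M ℚ.* linear 0 2 2 K M)
M-denominator K M = linear 3 2 4 K M ℚ.* linear 3 2 2 K M ℚ.* linear 2 1 2 K M
K-numerator   K M = ι (+ 18) ℚ.* (linear 3 3 4 K M ℚ.* linear 3 3 2 K M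
  ℚ.* (linear 3 0 4 K M ℚ.* linear 3 0 2 K M) ℚ.* linear 2 0 2 K M)
K-denominator K M = linear 3 2 6 K M ℚ.* (linear 3 2 4 K M ℚ.* linear 3 2 2 K M)
  ℚ.* (linear 2 1 4 K M ℚ.* linear 2 1 2 K M)

-- This is `K-numerator` times (3K + 2M + 8) w. In the same parametrisation μ₀ is `K-denominator`
-- times (3K + 2M + 8) w, so the extra factor drops out of the ratio.
scaledNumerator : (K M w : ℚ) → ℚ
scaledNumerator K M w = ι (+ 18) ℚ.* (linear 3 3 2 K M ℚ.* (linear 3 3 4 K M
  ℚ.* (linear 3 0 2 K M ℚ.* (linear 3 0 4 K M ℚ.* (linear 2 0 2 K M ℚ.* (linear 3 2 8 K M ℚ.* w))))))

-- ℓ (D ⊛ A), by the expression for D in terms of s and S found in D-s-S.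
discriminantMoment : (μ₀ μ₂ μ₃ μ₄ ν₀ ν₁ ν₂ ω₀ : ℚ) → ℚ
discriminantMoment μ₀ μ₂ μ₃ μ₄ ν₀ ν₁ ν₂ ω₀ =
  ι (+ 27) ℚ.* μ₀ ℚ.+ ((ℚ.- ι (+ 18)) ℚ.* (+ 1 / 4 ℚ.* ν₀ ℚ.+ + 1 / 4 ℚ.* μ₂)
    ℚ.+ (ι (+ 1) ℚ.* μ₃ ℚ.+ ((ℚ.- ι (+ 3)) ℚ.* ν₁
    ℚ.+ (ℚ.- ι (+ 1)) ℚ.* (+ 1 / 4 ℚ.* (+ 1 / 4 ℚ.* ω₀ ℚ.+ + 1 / 4 ℚ.* ν₂) ℚ.+ + 1 / 4 ℚ.*
        (+ 1 / 4 ℚ.* ν₂ ℚ.+ + 1 / 4 ℚ.* μ₄)))))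

discriminantMomentᵖ : ∀ {n} (μ₀ μ₂ μ₃ μ₄ ν₀ ν₁ ν₂ ω₀ : Polynomial n) → Polynomial n
discriminantMomentᵖ μ₀ μ₂ μ₃ μ₄ ν₀ ν₁ ν₂ ω₀ =
  # 27 :* μ₀ :+ (-# 18 :* (con (+ 1 / 4) :* ν₀ :+ con (+ 1 / 4) :* μ₂)
    :+ (# 1 :* μ₃ :+ (-# 3 :* ν₁
    :+ -# 1 :* (con (+ 1 / 4) :* (con (+ 1 / 4) :* ω₀ :+ con (+ 1 / 4) :* ν₂) :+ con (+ 1 / 4) :*
        (con (+ 1 / 4) :* ν₂ :+ con (+ 1 / 4) :* μ₄)))))

-- All moments in terms of w, which is μ₀ divided by their common denominator.
module _ (K M : ℚ) (cancel : Cancellative K M) (cancel′ : Cancellative K (M ℚ.+ ι (+ 2))) (w : ℚ) where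

  private
    M′ w₁ w₂ w₃ : ℚ
    M′ = M ℚ.+ ι (+ 2)
    w₁ = linear 3 2 8 K M ℚ.* (linear 2 1 4 K M ℚ.* w)
    w₂ = linear 3 2 6 K M ℚ.* w₁
    w₃ = leading₂ K M w
    w₁ᵖ w₂ᵖ w₃ᵖ : ∀ {n} → (K M w : Polynomial n) → Polynomial n
    w₁ᵖ K M w = linearᵖ 3 2 8 K M :* (linearᵖ 2 1 4 K M :* w)
    w₂ᵖ K M w = linearᵖ 3 2 6 K M :* w₁ᵖ K M w
    w₃ᵖ K M w = leading₂ᵖ K M w
    μ₀ᵖ μ₁ᵖ μ₂ᵖ μ₃ᵖ μ₄ᵖ ν₀ᵖ ν₁ᵖ ν₂ᵖ ω₀ᵖ : ∀ {n} → (K M w : Polynomial n) → Polynomial n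
    μ₀ᵖ K M w = leading₀ᵖ K M (w₂ᵖ K M w)
    μ₁ᵖ K M w = leading₁ᵖ K M (w₂ᵖ K M w)
    μ₂ᵖ K M w = P₂ᵖ K M :* w₂ᵖ K M w
    μ₃ᵖ K M w = P₃ᵖ K M :* w₁ᵖ K M w
    μ₄ᵖ K M w = P₄ᵖ K M :* w
    ν₀ᵖ K M w = leading₀ᵖ K (M :+ # 2) (w₃ᵖ K M w)
    ν₁ᵖ K M w = leading₁ᵖ K (M :+ # 2) (w₃ᵖ K M w)
    ν₂ᵖ K M w = P₂ᵖ K (M :+ # 2) :* w₃ᵖ K M w
    ω₀ᵖ K M w = leading₂ᵖ K (M :+ # 2) (w₃ᵖ K M w)

  solve-μ₃ : ∀ {μ₁ μ₂ μ₃ ν₁} →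
    μ₁ ≡ leading₁ K M w₂ → μ₂ ≡ P₂ K M ℚ.* w₂ → ν₁ ≡ leading₁ K M′ w₃ →
    sRelation 2 K M μ₁ μ₂ μ₃ ν₁ ≡ 0ℚ → μ₃ ≡ P₃ K M ℚ.* w₁
  solve-μ₃ {μ₃ = μ₃} refl refl refl e = cancel 3 2 4 (modulo _ _ 1ℚ _
    (solve 4 (λ K M w μ₃ →
      linearᵖ 3 2 5 K M :* μ₃ := linearᵖ 3 2 5 K M :* μ₃ᵖ K M w
        :+ con 1ℚ :* sRelationᵖ 2 K M (μ₁ᵖ K M w) (μ₂ᵖ K M w) μ₃ (ν₁ᵖ K M w))
      refl K M w μ₃) e)

  solve-μ₄ : ∀ {μ₂ μ₃ μ₄ ν₂} →
    μ₂ ≡ P₂ K M ℚ.* w₂ → μ₃ ≡ P₃ K M ℚ.* w₁ → ν₂ ≡ P₂ K M′ ℚ.* w₃ →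
    sRelation 3 K M μ₂ μ₃ μ₄ ν₂ ≡ 0ℚ → μ₄ ≡ P₄ K M ℚ.* w
  solve-μ₄ {μ₄ = μ₄} refl refl refl e = cancel 6 4 12 (modulo _ _ (ι (+ 2)) _
    (solve 4 (λ K M w μ₄ →
      linearᵖ 6 4 13 K M :* μ₄ := linearᵖ 6 4 13 K M :* μ₄ᵖ K M w
        :+ # 2 :* sRelationᵖ 3 K M (μ₂ᵖ K M w) (μ₃ᵖ K M w) μ₄ (ν₂ᵖ K M w))
      refl K M w μ₄) e)

  -- The extra factors in `w₂`, namely 3K + 2M + 6, 3K + 2M + 8 and 2K + M + 4, are the factors of
  -- `leading₀` with M replaced by M + 2. So `w₃` plays for the moments of S A the role that `w₂`
  -- plays for those of A.
  ν₀-shifted : leading₂ K M w₂ ≡ leading₀ K M′ w₃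
  ν₀-shifted = solve 3 (λ K M w → leading₂ᵖ K M (w₂ᵖ K M w) := ν₀ᵖ K M w) refl K M w

  solve-discriminant : ∀ {μ₀ μ₂ μ₃ μ₄ ν₀ ν₁ ν₂ ω₀} →
    μ₀ ≡ leading₀ K M w₂ → μ₂ ≡ P₂ K M ℚ.* w₂ → μ₃ ≡ P₃ K M ℚ.* w₁ → μ₄ ≡ P₄ K M ℚ.* w →
    ν₀ ≡ leading₀ K M′ w₃ → ν₁ ≡ leading₁ K M′ w₃ → ν₂ ≡ P₂ K M′ ℚ.* w₃ → ω₀ ≡ leading₂ K M′ w₃ →
    discriminantMoment μ₀ μ₂ μ₃ μ₄ ν₀ ν₁ ν₂ ω₀ ≡
      scaledNumerator K M w
  solve-discriminant refl refl refl refl refl refl refl refl = solve 3 (λ K M w →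
    discriminantMomentᵖ (μ₀ᵖ K M w) (μ₂ᵖ K M w) (μ₃ᵖ K M w) (μ₄ᵖ K M w) (ν₀ᵖ K M w) (ν₁ᵖ K M w)
        (ν₂ᵖ K M w) (ω₀ᵖ K M w)
    := # 18 :* (linearᵖ 3 3 2 K M :* (linearᵖ 3 3 4 K M :* (linearᵖ 3 0 2 K M :* (linearᵖ 3 0 4 K M
          :* (linearᵖ 2 0 2 K M :* (linearᵖ 3 2 8 K M :* w)))))))
    refl K M w

  -- Eight relations for eight unknown moments. Three at (K, M) give μ₁, ν₀, μ₂. As S A behaves like
  -- A with exponent M + 2, the same three at (K, M + 2) give ν₁, ω₀, ν₂. The relations of orders 2
  -- and 3 then give μ₃ and μ₄.
  moments⇒discriminant : ∀ {μ₀ μ₁ μ₂ μ₃ μ₄ ν₀ ν₁ ν₂ ω₀} → μ₀ ≡ leading₀ K M w₂ →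
    sRelation₀ K M μ₀ μ₁ ≡ 0ℚ → sRelation 1 K M μ₀ μ₁ μ₂ ν₀ ≡ 0ℚ → SRelation K M μ₀ μ₁ μ₂ ν₀ ≡ 0ℚ →
    sRelation₀ K M′ ν₀ ν₁ ≡ 0ℚ → sRelation 1 K M′ ν₀ ν₁ ν₂ ω₀ ≡ 0ℚ → SRelation K M′ ν₀ ν₁ ν₂ ω₀ ≡ 0ℚ →
    sRelation 2 K M μ₁ μ₂ μ₃ ν₁ ≡ 0ℚ → sRelation 3 K M μ₂ μ₃ μ₄ ν₂ ≡ 0ℚ →
    discriminantMoment μ₀ μ₂ μ₃ μ₄ ν₀ ν₁ ν₂ ω₀ ≡
      scaledNumerator K M w
  moments⇒discriminant {μ₀} {μ₁} {μ₂} {μ₃} {μ₄} {ν₀} {ν₁} {ν₂} {ω₀} μ₀≡ a₀ a₁ aT b₀ b₁ bT a₂ a₃ =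
    solve-discriminant μ₀≡ μ₂≡ μ₃≡ (solve-μ₄ {μ₄ = μ₄} μ₂≡ μ₃≡ ν₂≡ a₃) ν₀≡′ ν₁≡ ν₂≡ ω₀≡
    where
    μ₁≡ : μ₁ ≡ leading₁ K M w₂
    μ₁≡ = solve-μ₁ K M cancel (quadratic K M w₂) μ₀≡ a₀
    ν₀≡ : ν₀ ≡ leading₂ K M w₂
    ν₀≡ = solve-ν₀ K M cancel w₂ {μ₂ = μ₂} μ₀≡ μ₁≡ a₁ aT
    ν₀≡′ : ν₀ ≡ leading₀ K M′ w₃
    ν₀≡′ = trans ν₀≡ ν₀-shifted
    μ₂≡ : μ₂ ≡ P₂ K M ℚ.* w₂
    μ₂≡ = solve-μ₂ K M cancel w₂ μ₀≡ μ₁≡ ν₀≡ a₁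
    ν₁≡ : ν₁ ≡ leading₁ K M′ w₃
    ν₁≡ = solve-μ₁ K M′ cancel′ (quadratic K M′ w₃) ν₀≡′ b₀
    ω₀≡ : ω₀ ≡ leading₂ K M′ w₃
    ω₀≡ = solve-ν₀ K M′ cancel′ w₃ {μ₂ = ν₂} ν₀≡′ ν₁≡ b₁ bT
    ν₂≡ : ν₂ ≡ P₂ K M′ ℚ.* w₃
    ν₂≡ = solve-μ₂ K M′ cancel′ w₃ ν₀≡′ ν₁≡ ω₀≡ b₁
    μ₃≡ : μ₃ ≡ P₃ K M ℚ.* w₁
    μ₃≡ = solve-μ₃ μ₁≡ μ₂≡ ν₁≡ a₂

-- Makes the parametrisation by `w` available whatever the value of the zeroth moment.
leading₀-surjective : ∀ K M → Divisible K M → ∀ μ → ∃[ w ] μ ≡ leading₀ K M w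
leading₀-surjective K M divide μ = w , sym (trans
  (cong (linear 3 2 2 K M ℚ.*_) (trans (cong (linear 3 2 4 K M ℚ.*_) (proj₂ (divide 2 1 1 y₂)))
      (proj₂ (divide 3 2 3 y₁))))
  (proj₂ (divide 3 2 1 μ)))
  where
  y₁ y₂ w : ℚ
  y₁ = proj₁ (divide 3 2 1 μ)
  y₂ = proj₁ (divide 3 2 3 y₁)
  w  = proj₁ (divide 2 1 1 y₂)

module _ (K M : ℚ) (cancel : Cancellative K M) where

  S-ratio : ∀ w {μ₀ ν₀ g} → μ₀ ≡ leading₀ K M w → ν₀ ≡ leading₂ K M w →
    M-denominator K M ℚ.* g
      ≡ M-numerator K M ℚ.* μ₀ →
    ν₀ ≡ g
  S-ratio w {g = g} refl refl e = cancel 2 1 1 (cancel 3 2 3 (cancel 3 2 1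
    (trans (ratio K M w) (trans (sym e) (reorder (linear 3 2 4 K M) (linear 3 2 2 K M) (linear 2 1 2 K M) g)))))
    where
    ratio : ∀ K M w → linear 3 2 2 K M ℚ.* (linear 3 2 4 K M ℚ.* (linear 2 1 2 K M ℚ.* leading₂ K M w))
      ≡ M-numerator K M ℚ.* leading₀ K M w
    ratio = solve 3 (λ K M w →
      linearᵖ 3 2 2 K M :* (linearᵖ 3 2 4 K M :* (linearᵖ 2 1 2 K M :* leading₂ᵖ K M w))
      := (# 6 :* (linearᵖ 3 3 4 K M :* linearᵖ 3 3 2 K M :* linearᵖ 0 2 2 K M)) :* leading₀ᵖ K M w) refl
    reorder : ∀ x y z t → x ℚ.* y ℚ.* z ℚ.* t ≡ y ℚ.* (x ℚ.* (z ℚ.* t))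
    reorder = solve 4 (λ x y z t → x :* y :* z :* t := y :* (x :* (z :* t))) refl

  S-step : Divisible K M → ∀ {μ₀ μ₁ μ₂ ν₀ g} →
    sRelation₀ K M μ₀ μ₁ ≡ 0ℚ → sRelation 1 K M μ₀ μ₁ μ₂ ν₀ ≡ 0ℚ → SRelation K M μ₀ μ₁ μ₂ ν₀ ≡ 0ℚ →
    M-denominator K M ℚ.* g
      ≡ M-numerator K M ℚ.* μ₀ →
    ν₀ ≡ g
  S-step divide {μ₀} {μ₁} {μ₂} {ν₀} a₀ a₁ aT = S-ratio w μ₀≡
    (solve-ν₀ K M cancel w {μ₁ = μ₁} {μ₂} μ₀≡ (solve-μ₁ K M cancel (quadratic K M w) μ₀≡ a₀) a₁ aT)
    where
    w : ℚ
    w = proj₁ (leading₀-surjective K M divide μ₀)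
    μ₀≡ : μ₀ ≡ leading₀ K M w
    μ₀≡ = proj₂ (leading₀-surjective K M divide μ₀)

  private
    w₂ : ℚ → ℚ
    w₂ w = linear 3 2 6 K M ℚ.* (linear 3 2 8 K M ℚ.* (linear 2 1 4 K M ℚ.* w))

  D-ratio : ∀ w {μ₀ t g} → μ₀ ≡ leading₀ K M (w₂ w) → t ≡ scaledNumerator K M w →
    K-denominator K M ℚ.* g
      ≡ K-numerator K M ℚ.* μ₀ →
    t ≡ g
  D-ratio w {g = g} refl refl e = cancel 2 1 1 (cancel 2 1 3 (cancel 3 2 1 (cancel 3 2 3 (cancel 3 2 5
    (trans (ratio K M w) (trans (sym e) (reorder (linear 3 2 6 K M) (linear 3 2 4 K M) (linear 3 2 2 K M)
        (linear 2 1 4 K M) (linear 2 1 2 K M) g)))))))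
    where
    ratio : ∀ K M w → linear 3 2 6 K M ℚ.* (linear 3 2 4 K M ℚ.* (linear 3 2 2 K M ℚ.* (linear 2 1 4 K M ℚ.*
        (linear 2 1 2 K M ℚ.* scaledNumerator K M w))))
      ≡ K-numerator K M ℚ.* leading₀ K M (linear 3 2 6 K M ℚ.* (linear 3 2 8 K M ℚ.* (linear 2 1 4 K M ℚ.* w)))
    -- Only a permutation of factors, so the linear forms are handed to the solver as variables and
    -- never expanded in K and M.
    ratio K M w = trans
      (cong (λ x → linear 3 2 6 K M ℚ.* (linear 3 2 4 K M ℚ.*
          (linear 3 2 2 K M ℚ.* (linear 2 1 4 K M ℚ.* (linear 2 1 2 K M ℚ.* x)))))
        (solve 6 (λ a₂ a₄ b₂ b₄ c z → # 18 :* (a₂ :* (a₄ :* (b₂ :* (b₄ :* (c :* z)))))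
            := (# 18 :* (a₄ :* a₂ :* (b₄ :* b₂) :* c)) :* z) refl
          (linear 3 3 2 K M) (linear 3 3 4 K M) (linear 3 0 2 K M) (linear 3 0 4 K M) (linear 2 0 2 K M)
              (linear 3 2 8 K M ℚ.* w)))
      (solve 8 (λ p₂ p₄ p₆ p₈ q₂ q₄ x w → p₆ :* (p₄ :* (p₂ :* (q₄ :* (q₂ :* (x :* (p₈ :* w))))))
          := x :* (p₂ :* (p₄ :* (q₂ :* (p₆ :* (p₈ :* (q₄ :* w))))))) refl
        (linear 3 2 2 K M) (linear 3 2 4 K M) (linear 3 2 6 K M) (linear 3 2 8 K M) (linear 2 1 2 K M)
            (linear 2 1 4 K M)
        (K-numerator K M) w)
    reorder : ∀ x y z u v t → x ℚ.* (y ℚ.* z) ℚ.* (u ℚ.* v) ℚ.* t ≡ x ℚ.* (y ℚ.* (z ℚ.* (u ℚ.* (v ℚ.* t))))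
    reorder = solve 6 (λ x y z u v t → x :* (y :* z) :* (u :* v) :* t := x :*
        (y :* (z :* (u :* (v :* t))))) refl

  D-step : Divisible K M → Cancellative K (M ℚ.+ ι (+ 2)) → ∀ {μ₀ μ₁ μ₂ μ₃ μ₄ ν₀ ν₁ ν₂ ω₀ g} →
    let M′ = M ℚ.+ ι (+ 2) in
    sRelation₀ K M μ₀ μ₁ ≡ 0ℚ → sRelation 1 K M μ₀ μ₁ μ₂ ν₀ ≡ 0ℚ → SRelation K M μ₀ μ₁ μ₂ ν₀ ≡ 0ℚ →
    sRelation₀ K M′ ν₀ ν₁ ≡ 0ℚ → sRelation 1 K M′ ν₀ ν₁ ν₂ ω₀ ≡ 0ℚ → SRelation K M′ ν₀ ν₁ ν₂ ω₀ ≡ 0ℚ →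
    sRelation 2 K M μ₁ μ₂ μ₃ ν₁ ≡ 0ℚ → sRelation 3 K M μ₂ μ₃ μ₄ ν₂ ≡ 0ℚ →
    K-denominator K M ℚ.* g
      ≡ K-numerator K M ℚ.* μ₀ →
    discriminantMoment μ₀ μ₂ μ₃ μ₄ ν₀ ν₁ ν₂ ω₀ ≡ g
  D-step divide cancel′ {μ₀} {μ₁} {μ₂} {μ₃} {μ₄} {ν₀} {ν₁} {ν₂} {ω₀} a₀ a₁ aT b₀ b₁ bT a₂ a₃ =
    D-ratio w μ₀≡ (moments⇒discriminant K M cancel cancel′ w {μ₀} {μ₁} {μ₂} {μ₃} {μ₄} {ν₀} {ν₁} {ν₂}
        {ω₀} μ₀≡ a₀ a₁ aT b₀ b₁ bT a₂ a₃)
    where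
    x y₁ y₂ w : ℚ
    x  = proj₁ (leading₀-surjective K M divide μ₀)
    y₁ = proj₁ (divide 3 2 5 x)
    y₂ = proj₁ (divide 3 2 7 y₁)
    w  = proj₁ (divide 2 1 3 y₂)
    μ₀≡ : μ₀ ≡ leading₀ K M (linear 3 2 6 K M ℚ.* (linear 3 2 8 K M ℚ.* (linear 2 1 4 K M ℚ.* w)))
    μ₀≡ = trans (proj₂ (leading₀-surjective K M divide μ₀)) (cong (leading₀ K M) (sym (trans
      (cong (linear 3 2 6 K M ℚ.*_) (trans (cong (linear 3 2 8 K M ℚ.*_) (proj₂ (divide 2 1 3 y₂)))
          (proj₂ (divide 3 2 7 y₁))))
      (proj₂ (divide 3 2 5 x)))))

-- The recurrences of G

/-cross : ∀ B n′ d′ A n d .{{_ : NonZero d′}} .{{_ : NonZero d}} →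
  B * (n′ * d) ≡ A * (n * d′) →
  ι (+ B) ℚ.* (+ n′ / d′) ≡ ι (+ A) ℚ.* (+ n / d)
/-cross B n′ (suc d′) A n (suc d) e = ι-*-cancelˡ d _ _ (ι-*-cancelˡ d′ _ _ (begin
  ι (+ suc d′) ℚ.* (ι (+ suc d) ℚ.* (ι (+ B) ℚ.* x′))
    ≡⟨ solve 4 (λ d′ d b x → d′ :* (d :* (b :* x)) := b :* ((d′ :* x) :* d)) refl (ι (+ suc d′))
        (ι (+ suc d)) (ι (+ B)) x′ ⟩
  ι (+ B) ℚ.* (ι (+ suc d′) ℚ.* x′ ℚ.* ι (+ suc d))
    ≡⟨ cong (λ y → ι (+ B) ℚ.* (y ℚ.* ι (+ suc d))) (ι-*-/ (+ n′) (suc d′)) ⟩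
  ι (+ B) ℚ.* (ι (+ n′) ℚ.* ι (+ suc d))
    ≡⟨ product B n′ (suc d) ⟨
  ι (+ (B * (n′ * suc d)))
    ≡⟨ cong (λ z → ι (+ z)) e ⟩
  ι (+ (A * (n * suc d′)))
    ≡⟨ product A n (suc d′) ⟩
  ι (+ A) ℚ.* (ι (+ n) ℚ.* ι (+ suc d′))
    ≡⟨ cong (λ y → ι (+ A) ℚ.* (y ℚ.* ι (+ suc d′))) (ι-*-/ (+ n) (suc d)) ⟨
  ι (+ A) ℚ.* (ι (+ suc d) ℚ.* x ℚ.* ι (+ suc d′))
    ≡⟨ solve 4 (λ d′ d b x → d′ :* (d :* (b :* x)) := b :* ((d :* x) :* d′)) refl (ι (+ suc d′))
        (ι (+ suc d)) (ι (+ A)) x ⟨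
  ι (+ suc d′) ℚ.* (ι (+ suc d) ℚ.* (ι (+ A) ℚ.* x))
    ∎))
  where
  open ≡-Reasoning
  x′ x : ℚ
  x′ = + n′ / suc d′
  x = + n / suc d
  product : ∀ a b c → ι (+ (a * (b * c))) ≡ ι (+ a) ℚ.* (ι (+ b) ℚ.* ι (+ c))
  product a b c = trans (ι-pos-* a (b * c)) (cong (ι (+ a) ℚ.*_) (ι-pos-* b c))

infix 4 _↦_
record _↦_ (n : ℕ) (x : ℚ) : Set where
  constructor mk↦
  field
    ι≡ : ι (+ n) ≡ x

open _↦_

infixl 7 _⊠_
_⊠_ : ∀ {a b x y} → a ↦ x → b ↦ y → a * b ↦ x ℚ.* y
_⊠_ {a} {b} (mk↦ e) (mk↦ f) = mk↦ (trans (ι-pos-* a b) (cong₂ ℚ._*_ e f))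

-- Isolates the factor gained when the argument of a double factorial grows; `⊗` multiplies such
-- factors, so the double factorials themselves never enter the ring solver.
record Multiple (s n n′ : ℕ) : Set where
  constructor multiple
  field
    factored : n′ ≡ s * n

open Multiple

lin-3-3-6 : ∀ k m → 3 * k + 3 * m + 6 ≡ 3 * (k + m + 2)
lin-3-3-6 k m = sym (trans (ℕ.*-distribˡ-+ 3 (k + m) 2) (cong (_+ 6) (ℕ.*-distribˡ-+ 3 k m)))

!!₂ : ∀ {n} a {a₀} → n ≡ 2 + a → a ≡ a₀ → Multiple (a₀ + 2) (a !!) (n !!)
!!₂ a refl refl = multiple (cong (_* a !!) (ℕ.+-comm 2 a))

!!₄ : ∀ {n} a {a₀} → n ≡ 4 + a → a ≡ a₀ → Multiple ((a₀ + 4) * (a₀ + 2)) (a !!) (n !!)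
!!₄ a refl refl = multiple (trans (cong₂ _*_ (ℕ.+-comm 4 a) (factored (!!₂ a refl refl)))
  (sym (ℕ.*-assoc (a + 4) (a + 2) (a !!))))

!!₆ : ∀ {n} a {a₀} → n ≡ 6 + a → a ≡ a₀ → Multiple ((a₀ + 6) * ((a₀ + 4) * (a₀ + 2))) (a !!) (n !!)
!!₆ a refl refl = multiple (trans (cong₂ _*_ (ℕ.+-comm 6 a) (factored (!!₄ a refl refl)))
  (sym (ℕ.*-assoc (a + 6) ((a + 4) * (a + 2)) (a !!))))

infixl 7 _⊗_
_⊗_ : ∀ {s n n′ t o o′} → Multiple s n n′ → Multiple t o o′ → Multiple (s * t) (n * o) (n′ * o′)
_⊗_ {s} {n} {t = t} {o} (multiple refl) (multiple refl) = multiple (ℕ*.interchange s n t o)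

unscaled : ∀ {n} → Multiple 1 n n
unscaled {n} = multiple (sym (ℕ.*-identityˡ n))

cross : ∀ B A {s t n d n′ d′} → Multiple s n n′ → Multiple t d d′ → B * s ≡ A * t → B * (n′ * d) ≡ A * (n * d′)
cross B A {s} {t} {n} {d} (multiple refl) (multiple refl) e = begin
  B * (s * n * d)      ≡⟨ cong (B *_) (ℕ.*-assoc s n d) ⟩
  B * (s * (n * d))    ≡⟨ ℕ.*-assoc B s (n * d) ⟨
  B * s * (n * d)      ≡⟨ cong (_* (n * d)) e ⟩
  A * t * (n * d)      ≡⟨ ℕ.*-assoc A t (n * d) ⟩
  A * (t * (n * d))    ≡⟨ cong (A *_) (ℕ*.x∙yz≈y∙xz t n d) ⟩
  A * (n * (t * d))    ∎
  where open ≡-Reasoning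

module _ (k m : ℕ) where

  private
    K M : ℚ
    K = ι (+ k)
    M = ι (+ m)
    lin : ℕ → ℕ → ℕ → ℕ
    lin a b c = a * k + b * m + c
    lin↦ : ∀ a b c → lin a b c ↦ linear a b c K M
    lin↦ a b c = mk↦ (sym (ι-linear a b c k m))

  G-step : ∀ k′ m′ B A →
    B * (G-numerator k′ m′ * G-denominator k m) ≡ A * (G-numerator k m * G-denominator k′ m′) →
    ι (+ B) ℚ.* G k′ m′ ≡ ι (+ A) ℚ.* G k m
  G-step k′ m′ B A e = begin
    ι (+ B) ℚ.* ((+ 1 / 3) ℚ.* f k′ m′)      ≡⟨ swap (ι (+ B)) (f k′ m′) ⟩
    (+ 1 / 3) ℚ.* (ι (+ B) ℚ.* f k′ m′)      ≡⟨ cong ((+ 1 / 3) ℚ.*_)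
        (/-cross B (G-numerator k′ m′) (G-denominator k′ m′) A (G-numerator k m) (G-denominator k m)
        {{G-denominator≢0 k′ m′}} {{G-denominator≢0 k m}} e) ⟩
    (+ 1 / 3) ℚ.* (ι (+ A) ℚ.* f k m)        ≡⟨ swap (ι (+ A)) (f k m) ⟨
    ι (+ A) ℚ.* ((+ 1 / 3) ℚ.* f k m)        ∎
    where
    open ≡-Reasoning
    f : ℕ → ℕ → ℚ
    f k m = _/_ (+ G-numerator k m) (G-denominator k m) {{G-denominator≢0 k m}}
    swap : ∀ x y → x ℚ.* ((+ 1 / 3) ℚ.* y) ≡ (+ 1 / 3) ℚ.* (x ℚ.* y)
    swap x y = solve 3 (λ c x y → x :* (c :* y) := c :* (x :* y)) refl (+ 1 / 3) x y

  -- Of the factors gained, 3K + 3M + 6, 3K + 6 and 2K + 4 are 3, 3 and 2 times the factors K + M +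
  -- 2, K + 2 and K + 2 gained by the denominator. Their cancellation leaves the constant 18.
  G-step-K :
    K-denominator K M ℚ.* G (2 + k) m
    ≡ K-numerator K M ℚ.* G k m
  G-step-K = begin
    K-denominator K M ℚ.* G (2 + k) m
      ≡⟨ cong (ℚ._* G (2 + k) m) (ι≡ (lin↦ 3 2 6 ⊠ (lin↦ 3 2 4 ⊠ lin↦ 3 2 2) ⊠ (lin↦ 2 1 4 ⊠ lin↦ 2 1 2))) ⟨
    ι (+ (p₃ * p₂)) ℚ.* G (2 + k) m
      ≡⟨ G-step (2 + k) m (p₃ * p₂) (18 * (a * b * c)) naturals ⟩
    ι (+ (18 * (a * b * c))) ℚ.* G k m
      ≡⟨ cong (ℚ._* G k m) (ι≡ (mk↦ {18} refl ⊠ (lin↦ 3 3 4 ⊠ lin↦ 3 3 2 ⊠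
          (lin↦ 3 0 4 ⊠ lin↦ 3 0 2) ⊠ lin↦ 2 0 2))) ⟩
    K-numerator K M ℚ.* G k m
      ∎
    where
    open ≡-Reasoning
    p₃ p₂ a b c u v : ℕ
    p₃ = lin 3 2 6 * (lin 3 2 4 * lin 3 2 2)
    p₂ = lin 2 1 4 * lin 2 1 2
    a = lin 3 3 4 * lin 3 3 2
    b = lin 3 0 4 * lin 3 0 2
    c = lin 2 0 2
    u = k + m + 2
    v = k + 2
    numerator : Multiple (lin 3 3 6 * a * (lin 3 0 6 * b) * (lin 2 0 4 * c) * 1) (G-numerator k m)
        (G-numerator (2 + k) m)
    numerator =
      !!₆ (3 * k + 3 * m) (cong (_+ 3 * m) (ℕ.*-distribˡ-+ 3 2 k)) refl
      ⊗ !!₆ (3 * k) (ℕ.*-distribˡ-+ 3 2 k) (sym (ℕ.+-identityʳ (3 * k)))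
      ⊗ !!₄ (2 * k) (ℕ.*-distribˡ-+ 2 2 k) (sym (ℕ.+-identityʳ (2 * k)))
      ⊗ unscaled {(2 * m) !!}
    denominator : Multiple (p₃ * p₂ * u * v * v * 1) (G-denominator k m) (G-denominator (2 + k) m)
    denominator =
      !!₆ (3 * k + 2 * m) (cong (_+ 2 * m) (ℕ.*-distribˡ-+ 3 2 k)) refl
      ⊗ !!₄ (2 * k + m) (cong (_+ m) (ℕ.*-distribˡ-+ 2 2 k)) (cong (λ x → 2 * k + x) (sym (ℕ.+-identityʳ m)))
      ⊗ !!₂ (k + m) refl refl
      ⊗ !!₂ k refl refl
      ⊗ !!₂ k refl refl
      ⊗ unscaled {m !!}
    rearrange : ∀ p₃ p₂ a b c u v {r₁ r₂ r₃} → r₁ ≡ 3 * u → r₂ ≡ 3 * v → r₃ ≡ 2 * v →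
      p₃ * p₂ * (r₁ * a * (r₂ * b) * (r₃ * c) * 1) ≡ 18 * (a * b * c) * (p₃ * p₂ * u * v * v * 1)
    rearrange p₃ p₂ a b c u v refl refl refl = ℕS.solve 7 (λ p₃ p₂ a b c u v →
      p₃ ℕS.:* p₂ ℕS.:* (ℕS.con 3 ℕS.:* u ℕS.:* a ℕS.:* (ℕS.con 3 ℕS.:* v ℕS.:* b) ℕS.:*
          (ℕS.con 2 ℕS.:* v ℕS.:* c) ℕS.:* ℕS.con 1)
      ℕS.:= ℕS.con 18 ℕS.:* (a ℕS.:* b ℕS.:* c) ℕS.:* (p₃ ℕS.:* p₂ ℕS.:* u ℕS.:* v ℕS.:* v ℕS.:* ℕS.con 1)) refl
      p₃ p₂ a b c u v
    topFactor : ∀ a → a * k + 0 * m + a * 2 ≡ a * v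
    topFactor a = trans (cong (_+ a * 2) (ℕ.+-identityʳ (a * k))) (sym (ℕ.*-distribˡ-+ a k 2))
    naturals : p₃ * p₂ * (G-numerator (2 + k) m * G-denominator k m)
      ≡ 18 * (a * b * c) * (G-numerator k m * G-denominator (2 + k) m)
    naturals = cross (p₃ * p₂) (18 * (a * b * c)) numerator denominator
      (rearrange p₃ p₂ a b c u v (lin-3-3-6 k m) (topFactor 3) (topFactor 2))

  -- The constant 6 is 3 · 2, from 3K + 3M + 6 = 3(K + M + 2) and 2M + 4 = 2(M + 2).
  G-step-M :
    M-denominator K M ℚ.* G k (2 + m)
    ≡ M-numerator K M ℚ.* G k m
  G-step-M = begin
    M-denominator K M ℚ.* G k (2 + m)
      ≡⟨ cong (ℚ._* G k (2 + m)) (ι≡ (lin↦ 3 2 4 ⊠ lin↦ 3 2 2 ⊠ lin↦ 2 1 2)) ⟨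
    ι (+ (p₂ * p₁)) ℚ.* G k (2 + m)
      ≡⟨ G-step k (2 + m) (p₂ * p₁) (6 * (a * e)) naturals ⟩
    ι (+ (6 * (a * e))) ℚ.* G k m
      ≡⟨ cong (ℚ._* G k m) (ι≡ (mk↦ {6} refl ⊠ (lin↦ 3 3 4 ⊠ lin↦ 3 3 2 ⊠ lin↦ 0 2 2))) ⟩
    M-numerator K M ℚ.* G k m
      ∎
    where
    open ≡-Reasoning
    p₂ p₁ a e u v : ℕ
    p₂ = lin 3 2 4 * lin 3 2 2
    p₁ = lin 2 1 2
    a = lin 3 3 4 * lin 3 3 2
    e = lin 0 2 2
    u = k + m + 2
    v = m + 2
    shift : ∀ j x y → x + (j + y) ≡ j + (x + y)
    shift j x y = ℕ+.x∙yz≈y∙xz x j y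
    numerator : Multiple (lin 3 3 6 * a * 1 * 1 * (lin 0 2 4 * e)) (G-numerator k m) (G-numerator k (2 + m))
    numerator =
      !!₆ (3 * k + 3 * m) (trans (cong (λ x → 3 * k + x) (ℕ.*-distribˡ-+ 3 2 m)) (shift 6 (3 * k) (3 * m))) refl
      ⊗ unscaled {(3 * k) !!}
      ⊗ unscaled {(2 * k) !!}
      ⊗ !!₄ (2 * m) (ℕ.*-distribˡ-+ 2 2 m) refl
    denominator : Multiple (p₂ * p₁ * u * 1 * 1 * v) (G-denominator k m) (G-denominator k (2 + m))
    denominator =
      !!₄ (3 * k + 2 * m) (trans (cong (λ x → 3 * k + x) (ℕ.*-distribˡ-+ 2 2 m)) (shift 4 (3 * k) (2 * m))) refl
      ⊗ !!₂ (2 * k + m) (shift 2 (2 * k) m) (cong (λ x → 2 * k + x) (sym (ℕ.+-identityʳ m)))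
      ⊗ !!₂ (k + m) (shift 2 k m) refl
      ⊗ unscaled {k !!}
      ⊗ unscaled {k !!}
      ⊗ !!₂ m refl refl
    rearrange : ∀ p₂ p₁ a e u v {r₁ r₂} → r₁ ≡ 3 * u → r₂ ≡ 2 * v →
      p₂ * p₁ * (r₁ * a * 1 * 1 * (r₂ * e)) ≡ 6 * (a * e) * (p₂ * p₁ * u * 1 * 1 * v)
    rearrange p₂ p₁ a e u v refl refl = ℕS.solve 6 (λ p₂ p₁ a e u v →
      p₂ ℕS.:* p₁ ℕS.:* (ℕS.con 3 ℕS.:* u ℕS.:* a ℕS.:* ℕS.con 1 ℕS.:* ℕS.con 1 ℕS.:*
          (ℕS.con 2 ℕS.:* v ℕS.:* e))
      ℕS.:= ℕS.con 6 ℕS.:* (a ℕS.:* e) ℕS.:* (p₂ ℕS.:* p₁ ℕS.:* u ℕS.:* ℕS.con 1 ℕS.:* ℕS.con 1 ℕS.:* v)) refl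
      p₂ p₁ a e u v
    naturals : p₂ * p₁ * (G-numerator k (2 + m) * G-denominator k m)
      ≡ 6 * (a * e) * (G-numerator k m * G-denominator k (2 + m))
    naturals = cross (p₂ * p₁) (6 * (a * e)) numerator denominator
      (rearrange p₂ p₁ a e u v (lin-3-3-6 k m) (sym (ℕ.*-distribˡ-+ 2 m 2)))

-- Symmetry and logarithmic derivatives of V and d

module LS = SemiringSolver laurentSemiring
module ≈-Reasoning = Relation.Binary.Reasoning.Setoid (CommutativeSemiring.setoid laurentSemiring)

private
  variable
    A B X Y : Laurent
    σ : Weight → Weight
    K K′ M M′ χ χ′ : ℚ

≡⇒≈ : p ≡ q → p ≈ q
≡⇒≈ refl = ≈-refl

opaque
  -- Opaque, so that scalars stay atoms in symbolic rearrangements; it is unfolded where identities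
  -- are checked by evaluation.
  κ : ℚ → Laurent
  κ c = (c , 𝟎) ∷ []

  ⟦⟧-κ : ∀ c p F → ⟦ κ c ⊛ p ⟧ F ≡ c ℚ.* ⟦ p ⟧ F
  ⟦⟧-κ c p F = trans (⟦⟧-⊛ (κ c) p F) (trans (ℚ.+-identityʳ _)
    (cong (c ℚ.*_) (⟦⟧-cong p (λ u → cong F (⊕-identityˡ u)))))

  κ-+ : ∀ c d → κ c ++ κ d ≈ κ (c ℚ.+ d)
  κ-+ c d .at F = solve 3 (λ c d x → c :* x :+ (d :* x :+ con 0ℚ) := (c :+ d) :* x :+ con 0ℚ) refl c d (F 𝟎)

  κ-* : ∀ c d → κ c ⊛ κ d ≈ κ (c ℚ.* d)
  κ-* c d = ≡⇒≈ refl

  κ-1 : κ 1ℚ ≈ one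
  κ-1 = ≈-refl

  κ-0 : κ 0ℚ ≈ []
  κ-0 .at F = trans (ℚ.+-identityʳ _) (ℚ.*-zeroˡ (F 𝟎))

combination : List (ℚ × Laurent) → Laurent
combination []             = []
combination ((c , p) ∷ xs) = κ c ⊛ p ++ combination xs

-- The singleton clause avoids a trailing zero summand, so that the results unfold to the
-- expressions in `sRelation₀`, `sRelation` and `SRelation`.
linearly : (Laurent → ℚ) → List (ℚ × Laurent) → ℚ
linearly f []                      = 0ℚ
linearly f ((c , p) ∷ [])          = c ℚ.* f p
linearly f ((c , p) ∷ xs@(_ ∷ _))  = c ℚ.* f p ℚ.+ linearly f xs

⟦⟧-combination : ∀ xs B F → ⟦ combination xs ⊛ B ⟧ F ≡ linearly (λ p → ⟦ p ⊛ B ⟧ F) xs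
⟦⟧-combination []             B F = refl
⟦⟧-combination ((c , p) ∷ xs) B F = begin
  ⟦ (κ c ⊛ p ++ combination xs) ⊛ B ⟧ F
    ≡⟨ LS.solve 4 (λ k p c b → (k LS.:* p LS.:+ c) LS.:* b LS.:= k LS.:* (p LS.:* b) LS.:+ c
        LS.:* b) ≈-refl (κ c) p (combination xs) B .at F ⟩
  ⟦ κ c ⊛ (p ⊛ B) ++ combination xs ⊛ B ⟧ F
    ≡⟨ ⟦⟧-++ (κ c ⊛ (p ⊛ B)) (combination xs ⊛ B) F ⟩
  ⟦ κ c ⊛ (p ⊛ B) ⟧ F ℚ.+ ⟦ combination xs ⊛ B ⟧ F
    ≡⟨ cong₂ ℚ._+_ (⟦⟧-κ c (p ⊛ B) F) (⟦⟧-combination xs B F) ⟩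
  c ℚ.* ⟦ p ⊛ B ⟧ F ℚ.+ linearly (λ p → ⟦ p ⊛ B ⟧ F) xs
    ≡⟨ final xs ⟩
  linearly (λ p → ⟦ p ⊛ B ⟧ F) ((c , p) ∷ xs)
    ∎
  where
  open ≡-Reasoning
  final : ∀ xs → c ℚ.* ⟦ p ⊛ B ⟧ F ℚ.+ linearly (λ p → ⟦ p ⊛ B ⟧ F) xs ≡ linearly (λ p → ⟦ p ⊛ B ⟧ F)
      ((c , p) ∷ xs)
  final []      = ℚ.+-identityʳ _
  final (_ ∷ _) = refl

act : (Weight → Weight) → Laurent → Laurent
act σ = List.map λ (c , u) → (c , σ u)

⟦⟧-act : ∀ σ p F → ⟦ act σ p ⟧ F ≡ ⟦ p ⟧ (F ∘ σ)
⟦⟧-act σ p F = ⟦⟧-map _ F (F ∘ σ) (λ _ _ → refl) p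

act-cong : p ≈ q → act σ p ≈ act σ q
act-cong {p} {q} {σ} e .at F = trans (⟦⟧-act σ p F) (trans (e .at (F ∘ σ)) (sym (⟦⟧-act σ q F)))

record Automorphism (σ : Weight → Weight) : Set where
  field
    homo      : ∀ u v → σ (u ⊕ v) ≡ σ u ⊕ σ v
    preserves : σ 𝟎 ≡ 𝟎
    reflects  : ∀ u → σ u ≡ 𝟎 → u ≡ 𝟎

  act-⊛ : ∀ p q → act σ (p ⊛ q) ≈ act σ p ⊛ act σ q
  act-⊛ p q .at F = begin
    ⟦ act σ (p ⊛ q) ⟧ F                            ≡⟨ trans (⟦⟧-act σ (p ⊛ q) F) (⟦⟧-⊛ p q (F ∘ σ)) ⟩
    ⟦ p ⟧ (λ u → ⟦ q ⟧ (λ v → F (σ (u ⊕ v))))      ≡⟨ ⟦⟧-cong p (λ u → ⟦⟧-cong q (λ v → cong F (homo u v))) ⟩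
    ⟦ p ⟧ (λ u → ⟦ q ⟧ (λ v → F (σ u ⊕ σ v)))      ≡⟨ ⟦⟧-cong p (λ u → ⟦⟧-act σ q _) ⟨
    ⟦ p ⟧ (λ u → ⟦ act σ q ⟧ (λ v → F (σ u ⊕ v)))  ≡⟨ ⟦⟧-act σ p _ ⟨
    ⟦ act σ p ⟧ (λ u → ⟦ act σ q ⟧ (λ v → F (u ⊕ v))) ≡⟨ ⟦⟧-⊛ (act σ p) (act σ q) F ⟨
    ⟦ act σ p ⊛ act σ q ⟧ F                        ∎
    where open ≡-Reasoning

  act-δ₀ : ∀ p → ⟦ act σ p ⟧ δ₀ ≡ ⟦ p ⟧ δ₀
  act-δ₀ p = trans (⟦⟧-act σ p δ₀) (⟦⟧-cong p λ u → invariant u)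
    where
    invariant : ∀ u → δ₀ (σ u) ≡ δ₀ u
    invariant u with σ u ≟ 𝟎 | u ≟ 𝟎
    ... | yes _ | yes _ = refl
    ... | no  _ | no  _ = refl
    ... | yes e | no ¬e = ⊥-elim (¬e (reflects u e))
    ... | no ¬e | yes e = ⊥-elim (¬e (trans (cong σ e) preserves))

open Automorphism

Semiinvariant : (Weight → Weight) → ℚ → Laurent → Set
Semiinvariant σ χ A = act σ A ≈ κ χ ⊛ A

module _ (σ-auto : Automorphism σ) where

  semiinvariant-⊛ : Semiinvariant σ χ A → Semiinvariant σ χ′ B → Semiinvariant σ (χ ℚ.* χ′) (A ⊛ B)
  semiinvariant-⊛ {χ} {A} {χ′} {B} a b = begin
    act σ (A ⊛ B)                     ≈⟨ act-⊛ σ-auto A B ⟩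
    act σ A ⊛ act σ B                 ≈⟨ ⊛-cong a b ⟩
    (κ χ ⊛ A) ⊛ (κ χ′ ⊛ B)            ≈⟨ LS.solve 4
        (λ k a l b → (k LS.:* a) LS.:* (l LS.:* b) LS.:= (k LS.:* l) LS.:* (a LS.:* b)) ≈-refl (κ χ) A
        (κ χ′) B ⟩
    (κ χ ⊛ κ χ′) ⊛ (A ⊛ B)            ≈⟨ ⊛-cong (κ-* χ χ′) ≈-refl ⟩
    κ (χ ℚ.* χ′) ⊛ (A ⊛ B)            ∎
    where open ≈-Reasoning

orbitSum : (Weight → Weight) → Laurent → Laurent
orbitSum ρ y = y ++ (act ρ y ++ act ρ (act ρ y))

-- ρ and τ generate a copy of S₃; y has no component on which it acts by the sign, A has no other.
antisymmetric-CT : ∀ {ρ τ} → Automorphism ρ → Automorphism τ → ∀ {y A} →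
  act τ (orbitSum ρ y) ≈ orbitSum ρ y → Semiinvariant ρ 1ℚ A → Semiinvariant τ (ℚ.- 1ℚ) A →
  ⟦ y ⊛ A ⟧ δ₀ ≡ 0ℚ
antisymmetric-CT {ρ} {τ} ρ-auto τ-auto {y} {A} y-sym ρA τA = vanish
    (trans (sym z≡3c) (trans z≡-z (cong ((ℚ.- 1ℚ) ℚ.*_) z≡3c)))
  where
  open ≡-Reasoning
  c : ℚ
  c = ⟦ y ⊛ A ⟧ δ₀
  z : Laurent
  z = orbitSum ρ y
  -- The constant term is invariant under `ρ`, and `ρ` fixes `A`, so the three rotations of `y`
  -- contribute equally. As `τ` fixes their sum and negates `A`, this forces 3c = -3c.
  rotate : ∀ y → ⟦ act ρ y ⊛ A ⟧ δ₀ ≡ ⟦ y ⊛ A ⟧ δ₀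
  rotate y = sym (trans (sym (act-δ₀ ρ-auto (y ⊛ A)))
    (≈-trans (act-⊛ ρ-auto y A) (⊛-cong (≈-refl {act ρ y})
        (≈-trans ρA (≈-trans (⊛-cong κ-1 ≈-refl) (⊛-identityˡ A)))) .at δ₀))
  z≡3c : ⟦ z ⊛ A ⟧ δ₀ ≡ c ℚ.+ (c ℚ.+ c)
  z≡3c = begin
    ⟦ z ⊛ A ⟧ δ₀
      ≡⟨ ≈-trans (⊛-distribʳ-++ A y (act ρ y ++ act ρ (act ρ y)))
          (++-cong ≈-refl (⊛-distribʳ-++ A (act ρ y) (act ρ (act ρ y)))) .at δ₀ ⟩
    ⟦ y ⊛ A ++ (act ρ y ⊛ A ++ act ρ (act ρ y) ⊛ A) ⟧ δ₀
      ≡⟨ trans (⟦⟧-++ (y ⊛ A) _ δ₀) (cong (c ℚ.+_) (⟦⟧-++ (act ρ y ⊛ A) _ δ₀)) ⟩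
    c ℚ.+ (⟦ act ρ y ⊛ A ⟧ δ₀ ℚ.+ ⟦ act ρ (act ρ y) ⊛ A ⟧ δ₀)
      ≡⟨ cong (c ℚ.+_) (cong₂ ℚ._+_ (rotate y) (trans (rotate (act ρ y)) (rotate y))) ⟩
    c ℚ.+ (c ℚ.+ c)
      ∎
  z≡-z : ⟦ z ⊛ A ⟧ δ₀ ≡ (ℚ.- 1ℚ) ℚ.* ⟦ z ⊛ A ⟧ δ₀
  z≡-z = begin
    ⟦ z ⊛ A ⟧ δ₀                       ≡⟨ act-δ₀ τ-auto (z ⊛ A) ⟨
    ⟦ act τ (z ⊛ A) ⟧ δ₀               ≡⟨ ≈-trans (act-⊛ τ-auto z A) (⊛-cong y-sym τA) .at δ₀ ⟩
    ⟦ z ⊛ (κ (ℚ.- 1ℚ) ⊛ A) ⟧ δ₀        ≡⟨ LS.solve 3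
        (λ z k a → z LS.:* (k LS.:* a) LS.:= k LS.:* (z LS.:* a)) ≈-refl z (κ (ℚ.- 1ℚ)) A .at δ₀ ⟩
    ⟦ κ (ℚ.- 1ℚ) ⊛ (z ⊛ A) ⟧ δ₀        ≡⟨ ⟦⟧-κ (ℚ.- 1ℚ) (z ⊛ A) δ₀ ⟩
    (ℚ.- 1ℚ) ℚ.* ⟦ z ⊛ A ⟧ δ₀          ∎
  vanish : c ℚ.+ (c ℚ.+ c) ≡ (ℚ.- 1ℚ) ℚ.* (c ℚ.+ (c ℚ.+ c)) → c ≡ 0ℚ
  vanish e = begin
    c                                       ≡⟨ solve 1
        (λ c → c := con (+ 1 / 6) :* ((c :+ (c :+ c)) :- con (ℚ.- 1ℚ) :* (c :+ (c :+ c)))) refl c ⟩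
    (+ 1 / 6) ℚ.* (t ℚ.- (ℚ.- 1ℚ) ℚ.* t)    ≡⟨ cong (λ x → (+ 1 / 6) ℚ.* (x ℚ.- (ℚ.- 1ℚ) ℚ.* t)) e ⟩
    (+ 1 / 6) ℚ.* ((ℚ.- 1ℚ) ℚ.* t ℚ.- (ℚ.- 1ℚ) ℚ.* t) ≡⟨ solve 1
        (λ t → con (+ 1 / 6) :* (con (ℚ.- 1ℚ) :* t :- con (ℚ.- 1ℚ) :* t) := con 0ℚ) refl t ⟩
    0ℚ                                      ∎
    where
    t : ℚ
    t = c ℚ.+ (c ℚ.+ c)

-- Satisfied by A = V^K d^M when Γ q V = X V and Γ q d = Y d.
Eigen : (q X Y : Laurent) → (K M : ℚ) → Laurent → Set
Eigen q X Y K M A = Γ q A ≈ (κ K ⊛ X ++ κ M ⊛ Y) ⊛ A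

eigen-cong : A ≈ B → Eigen q X Y K M A → Eigen q X Y K M B
eigen-cong {q = q} {X} {Y} {K} {M} e a = ≈-trans (Γ-congʳ {p = q} (≈-sym e))
  (≈-trans a (⊛-cong (≈-refl {κ K ⊛ X ++ κ M ⊛ Y}) e))

-- Logarithmic derivatives add under multiplication, by the Leibniz rule; this is what makes K and M
-- behave as exponents.
eigen-⊛ : Eigen q X Y K M A → Eigen q X Y K′ M′ B → Eigen q X Y (K ℚ.+ K′) (M ℚ.+ M′) (A ⊛ B)
eigen-⊛ {q} {X} {Y} {K} {M} {A} {K′} {M′} {B} a b = begin
  Γ q (A ⊛ B)
    ≈⟨ Γ-⊛ q A B ⟩
  Γ q A ⊛ B ++ A ⊛ Γ q B
    ≈⟨ ++-cong (⊛-cong a (≈-refl {B})) (⊛-cong (≈-refl {A}) b) ⟩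
  ((κ K ⊛ X ++ κ M ⊛ Y) ⊛ A) ⊛ B ++ A ⊛ ((κ K′ ⊛ X ++ κ M′ ⊛ Y) ⊛ B)
    ≈⟨ LS.solve 8 (λ k k′ m m′ x y a b →
         ((k LS.:* x LS.:+ m LS.:* y) LS.:* a) LS.:* b LS.:+ a LS.:* ((k′ LS.:* x LS.:+ m′ LS.:* y) LS.:* b)
         LS.:= ((k LS.:+ k′) LS.:* x LS.:+ (m LS.:+ m′) LS.:* y) LS.:* (a LS.:* b)) ≈-refl
         (κ K) (κ K′) (κ M) (κ M′) X Y A B ⟩
  ((κ K ++ κ K′) ⊛ X ++ (κ M ++ κ M′) ⊛ Y) ⊛ (A ⊛ B)
    ≈⟨ ⊛-cong (++-cong (⊛-cong (κ-+ K K′) (≈-refl {X})) (⊛-cong (κ-+ M M′) (≈-refl {Y}))) (≈-refl {A ⊛ B}) ⟩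
  (κ (K ℚ.+ K′) ⊛ X ++ κ (M ℚ.+ M′) ⊛ Y) ⊛ (A ⊛ B)
    ∎
  where open ≈-Reasoning

Γ-κ : ∀ q c → Γ q (κ c) ≈ []
Γ-κ q c .at F = begin
  ⟦ Γ q (κ c) ⟧ F                                                ≡⟨ ⟦⟧-Γ q (κ c) F ⟩
  ⟦ q ⟧ (λ u → ⟦ κ c ⟧ (λ v → (u ∙ v) ℚ.* F (u ⊕ v)))            ≡⟨ ⟦⟧-cong q
      (λ u → value (λ v → (u ∙ v) ℚ.* F (u ⊕ v)) (zero-weight u)) ⟩
  ⟦ q ⟧ (λ u → 0ℚ)                                               ≡⟨ ⟦⟧-0 q ⟩
  0ℚ                                                             ∎
  where
  open ≡-Reasoning
  zero-weight : ∀ u → (u ∙ 𝟎) ℚ.* F (u ⊕ 𝟎) ≡ 0ℚ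
  zero-weight u = trans (cong (ℚ._* F (u ⊕ 𝟎)) (trans (cong (u ∙_) (sym (0·β≡𝟎 u)))
      (trans (∙-·ʳ 0 u u) (ℚ.*-zeroˡ (u ∙ u))))) (ℚ.*-zeroˡ (F (u ⊕ 𝟎)))
  value : ∀ (H : Formal) → H 𝟎 ≡ 0ℚ → ⟦ κ c ⟧ H ≡ 0ℚ
  value H e = trans (sym (≈-trans (⊛-comm (κ c) one) (⊛-identityˡ (κ c)) .at H)) (trans (⟦⟧-κ c one H)
    (trans (cong (λ x → c ℚ.* (1ℚ ℚ.* x ℚ.+ 0ℚ)) e) (ℚ.*-zeroʳ c)))

eigen-κ : ∀ {q X Y} c → Eigen q X Y 0ℚ 0ℚ (κ c)
eigen-κ {q} {X} {Y} c = ≈-trans (Γ-κ q c) (≈-sym (⊛-cong (++-cong (⊛-cong κ-0 (≈-refl {X}))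
    (⊛-cong κ-0 (≈-refl {Y}))) (≈-refl {κ c})))

Γ-^ : ∀ q p n → Γ q (p ^ suc n) ≈ κ (ι (+ suc n)) ⊛ (p ^ n ⊛ Γ q p)
Γ-^ q p zero = begin
  Γ q (p ⊛ one)                         ≈⟨ Γ-congʳ {p = q} (≈-trans (⊛-comm p one) (⊛-identityˡ p)) ⟩
  Γ q p                                 ≈⟨ ≈-trans (⊛-cong κ-1 (≈-refl {one ⊛ Γ q p}))
      (≈-trans (⊛-identityˡ (one ⊛ Γ q p)) (⊛-identityˡ (Γ q p))) ⟨
  κ (ι (+ 1)) ⊛ (one ⊛ Γ q p)           ∎
  where open ≈-Reasoning
Γ-^ q p (suc n) = begin
  Γ q (p ⊛ p ^ suc n)
    ≈⟨ Γ-⊛ q p (p ^ suc n) ⟩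
  Γ q p ⊛ p ^ suc n ++ p ⊛ Γ q (p ^ suc n)
    ≈⟨ ++-cong (≈-refl {Γ q p ⊛ p ^ suc n}) (⊛-cong (≈-refl {p}) (Γ-^ q p n)) ⟩
  Γ q p ⊛ (p ⊛ p ^ n) ++ p ⊛ (κ (ι (+ suc n)) ⊛ (p ^ n ⊛ Γ q p))
    ≈⟨ LS.solve 4 (λ g p pn k → g LS.:* (p LS.:* pn) LS.:+ p LS.:* (k LS.:* (pn LS.:* g))
        LS.:= (LS.con 1 LS.:+ k) LS.:* ((p LS.:* pn) LS.:* g)) ≈-refl
         (Γ q p) p (p ^ n) (κ (ι (+ suc n))) ⟩
  (one ++ κ (ι (+ suc n))) ⊛ (p ^ suc n ⊛ Γ q p)
    ≈⟨ ⊛-cong (≈-trans (++-cong (≈-sym κ-1) (≈-refl {κ (ι (+ suc n))}))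
        (≈-trans (κ-+ 1ℚ (ι (+ suc n))) (≡⇒≈ (cong κ (sym (ι-+ 1ℤ (+ suc n))))))) (≈-refl {p ^ suc n ⊛ Γ q p}) ⟩
  κ (ι (+ suc (suc n))) ⊛ (p ^ suc n ⊛ Γ q p)
    ∎
  where open ≈-Reasoning

eᵘ : List Weight → Laurent
eᵘ = List.map (1ℚ ,_)

-- With a, b, c = e^(ε₁ - ε₂), e^(ε₂ - ε₃), e^(ε₃ - ε₁): s = a + b + c + 1/a + 1/b + 1/c,
-- N = (a + b + c)(1/a + 1/b + 1/c), V = (a - b)(a - c)(b - c) and
-- d = a + b + c - 1/a - 1/b - 1/c.
opaque
  s S D N : Laurent
  s = eᵘ Φₛ
  S = ∏ Φₛ 1-e^_
  D = ∏ Φₗ 1-e^_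
  N = eᵘ orbit ⊛ eᵘ (List.map ⊖_ orbit)
    where
    orbit : List Weight
    orbit = α₁ ∷ α₁ ⊕ α₂ ∷ ⊖ (2 · α₁ ⊕ α₂) ∷ []

  V d : Laurent
  V = e^ (⊖ (3 · α₁) ⊝ 2 · α₂) ⊛ ∏ Φₗ⁺ 1-e^_
  d = e^ (⊖ (2 · α₁) ⊝ α₂) ⊛ ∏ Φₛ⁺ 1-e^_

-- Expansions in `s` and `S` of |∇s|², of the Laplacians of `s` and `S`, and of the logarithmic
-- derivatives of `V` (X) and `d` (Y) along ∇s and ∇S. The last are polynomials because `Γ q V` and
-- `Γ q d`, for invariant q, transform under the Weyl group like `V` and `d` and hence are divisible
-- by them.
Γₛₛ Δₛ ΔS Xₛ Yₛ XS YS : List (ℚ × Laurent)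
Γₛₛ = (+ 3 / 2 , s ⊛ s) ∷ (ℚ.- (+ 1 / 2) , S) ∷ (ℚ.- ι (+ 6) , s) ∷ (ℚ.- ι (+ 18) , one) ∷ []
Δₛ  = (ι (+ 2) , s) ∷ []
ΔS = (ℚ.- ι (+ 36) , one) ∷ (ι (+ 7) , S) ∷ (ι (+ 12) , s) ∷ (ℚ.- ι (+ 1) , s ⊛ s) ∷ []
Xₛ  = (ι (+ 3) , s) ∷ []
Yₛ  = (ι (+ 2) , s) ∷ (ι (+ 6) , one) ∷ []
XS = (ι (+ 6) , S) ∷ []
YS = (ℚ.- ι (+ 36) , one) ∷ (ι (+ 3) , S) ∷ (ι (+ 12) , s) ∷ (ℚ.- ι (+ 1) , s ⊛ s) ∷ []

record Weighted (K M : ℚ) (A : Laurent) : Set where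
  field
    along-s : Eigen s (combination Xₛ) (combination Yₛ) K M A
    along-S : Eigen S (combination XS) (combination YS) K M A

opaque
  unfolding κ s

  Γ-s-s : Γ s s ≈ combination Γₛₛ
  Γ-s-s = ≈-by-computation _ _ tt

  Δ-s : Δ s ≈ combination Δₛ
  Δ-s = ≈-by-computation _ _ tt

  Δ-S : Δ S ≈ combination ΔS
  Δ-S = ≈-by-computation _ _ tt

  weighted-V : Weighted 1ℚ 0ℚ V
  weighted-V = record { along-s = ≈-by-computation _ _ tt ; along-S = ≈-by-computation _ _ tt }

  weighted-d : Weighted 0ℚ 1ℚ d
  weighted-d = record { along-s = ≈-by-computation _ _ tt ; along-S = ≈-by-computation _ _ tt }

  D≈-V² : κ (ℚ.- 1ℚ) ⊛ (V ⊛ V) ≈ D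
  D≈-V² = ≈-by-computation _ _ tt

  S≈-d² : κ (ℚ.- 1ℚ) ⊛ (d ⊛ d) ≈ S
  S≈-d² = ≈-by-computation _ _ tt

  N-s-S : N ≈ combination ((+ 1 / 4 , S) ∷ (+ 1 / 4 , s ⊛ s) ∷ [])
  N-s-S = ≈-by-computation _ _ tt

  -- The discriminant of a cubic. As abc = 1, the elementary symmetric functions of a, b, c are e₁ =
  -- a + b + c, e₂ = 1/a + 1/b + 1/c and 1, so -V² = 27 - 18 e₁e₂ + 4(e₁³ + e₂³) - e₁²e₂².
  -- Substitute e₁ + e₂ = s, e₁e₂ = N and 4N = S + s² in the cubic terms.
  D-s-S : D ≈ combination ((ι (+ 27) , one) ∷ (ℚ.- ι (+ 18) , N) ∷ (ι (+ 1) , s ⊛ (s ⊛ s)) ∷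
      (ℚ.- ι (+ 3) , s ⊛ S) ∷ (ℚ.- ι (+ 1) , N ⊛ N) ∷ [])
  D-s-S = ≈-by-computation _ _ tt

open Weighted

weighted-cong : A ≈ B → Weighted K M A → Weighted K M B
weighted-cong {K = K} {M} e a = record
  { along-s = eigen-cong {q = s} {K = K} {M = M} e (along-s a)
  ; along-S = eigen-cong {q = S} {K = K} {M = M} e (along-S a) }

weighted-⊛ : ∀ {K M A K′ M′ B} → Weighted K M A → Weighted K′ M′ B →
  Weighted (K ℚ.+ K′) (M ℚ.+ M′) (A ⊛ B)
weighted-⊛ {K} {M} {A} {K′} {M′} {B} a b = record
  { along-s = eigen-⊛ {s} {combination Xₛ} {combination Yₛ} {K} {M} {A} {K′} {M′} {B} (along-s a) (along-s b)
  ; along-S = eigen-⊛ {S} {combination XS} {combination YS} {K} {M} {A} {K′} {M′} {B} (along-S a) (along-S b) }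

weighted-κ : ∀ c → Weighted 0ℚ 0ℚ (κ c)
weighted-κ c = record
  { along-s = eigen-κ {s} {combination Xₛ} {combination Yₛ} c
  ; along-S = eigen-κ {S} {combination XS} {combination YS} c }

weighted-D : Weighted (ι (+ 2)) 0ℚ D
weighted-D = weighted-cong D≈-V² (weighted-⊛ (weighted-κ (ℚ.- 1ℚ)) (weighted-⊛ weighted-V weighted-V))

weighted-S : Weighted 0ℚ (ι (+ 2)) S
weighted-S = weighted-cong S≈-d² (weighted-⊛ (weighted-κ (ℚ.- 1ℚ)) (weighted-⊛ weighted-d weighted-d))

-- Relations between the moments

ρ : Weight → Weight
ρ (x ∷ y ∷ z ∷ []) = z ∷ x ∷ y ∷ []

ρ-auto : Automorphism ρ
ρ-auto = record
  { homo = λ { (_ ∷ _ ∷ _ ∷ []) (_ ∷ _ ∷ _ ∷ []) → refl }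
  ; preserves = refl
  ; reflects = λ { (_ ∷ _ ∷ _ ∷ []) refl → refl } }

opaque
  unfolding κ s

  ρ-s : Semiinvariant ρ 1ℚ s
  ρ-s = ≈-by-computation _ _ tt

  ρ-S : Semiinvariant ρ 1ℚ S
  ρ-S = ≈-by-computation _ _ tt

  ρ-D : Semiinvariant ρ 1ℚ D
  ρ-D = ≈-by-computation _ _ tt

-- The quotients hₛ and hS are what integrationByParts leaves of ∇s and ∇S along β.
record Wall (β : Weight) : Set where
  field
    unit   : ∣head∣ β ≡ 1
    τ      : Weight → Weight
    τ-auto : Automorphism τ
    τ-s    : Semiinvariant τ 1ℚ s
    τ-S    : Semiinvariant τ 1ℚ S
    τ-D    : Semiinvariant τ 1ℚ D
    hₛ hS : Laurent
    ∂-s    : ∂ β s ≈ 1-e^ β ⊛ hₛ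
    ∂-S    : ∂ β S ≈ 1-e^ β ⊛ hS
    hₛ-sym : act τ (orbitSum ρ (e^ β ⊛ hₛ)) ≈ orbitSum ρ (e^ β ⊛ hₛ)
    hS-sym : act τ (orbitSum ρ (e^ β ⊛ hS)) ≈ orbitSum ρ (e^ β ⊛ hS)

module _ {β : Weight} (wall : Wall β) where

  open Wall wall

  private
    ℓ : Laurent → ℚ
    ℓ = logCT β

  record Antisymmetric (A : Laurent) : Set where
    field
      under-ρ : Semiinvariant ρ 1ℚ A
      under-τ : Semiinvariant τ (ℚ.- 1ℚ) A

  open Antisymmetric

  antisymmetric-⊛ : ∀ {A B} → Semiinvariant ρ 1ℚ A → Semiinvariant τ 1ℚ A → Antisymmetric B →
      Antisymmetric (A ⊛ B)
  antisymmetric-⊛ ρA τA b = record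
    { under-ρ = semiinvariant-⊛ ρ-auto ρA (under-ρ b)
    ; under-τ = semiinvariant-⊛ τ-auto τA (under-τ b) }

  antisymmetric-cong : ∀ {A B} → A ≈ B → Antisymmetric A → Antisymmetric B
  antisymmetric-cong {A} {B} e a = record
    { under-ρ = ≈-trans (act-cong (≈-sym e)) (≈-trans (under-ρ a) (⊛-cong (≈-refl {κ 1ℚ}) e))
    ; under-τ = ≈-trans (act-cong (≈-sym e)) (≈-trans (under-τ a) (⊛-cong (≈-refl {κ (ℚ.- 1ℚ)}) e)) }

  antisymmetric-s^ : ∀ n {A} → Antisymmetric A → Antisymmetric (s ^ n ⊛ A)
  antisymmetric-s^ zero    {A} a = antisymmetric-cong (≈-sym (⊛-identityˡ A)) a
  antisymmetric-s^ (suc n) {A} a = antisymmetric-cong (≈-sym (⊛-assoc s (s ^ n) A))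
    (antisymmetric-⊛ ρ-s τ-s (antisymmetric-s^ n a))

  ibp-vanish : ∀ q h → ∂ β q ≈ 1-e^ β ⊛ h →
    act τ (orbitSum ρ (e^ β ⊛ h)) ≈ orbitSum ρ (e^ β ⊛ h) →
    ∀ {P} → Antisymmetric P → ℓ (Δ q ⊛ P ++ Γ q P) ≡ 0ℚ
  ibp-vanish q h ∂q h-sym {P} a = begin
    ℓ (Δ q ⊛ P ++ Γ q P)
      ≡⟨ integrationByParts β unit q P (h ⊛ P) (≈-trans (⊛-cong ∂q (≈-refl {P})) (⊛-assoc (1-e^ β) h P)) ⟩
    ⟦ e^ β ⊛ (h ⊛ P) ⟧ δ₀
      ≡⟨ ⊛-assoc (e^ β) h P .at δ₀ ⟨
    ⟦ (e^ β ⊛ h) ⊛ P ⟧ δ₀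
      ≡⟨ antisymmetric-CT ρ-auto τ-auto {e^ β ⊛ h} {P} h-sym (under-ρ a) (under-τ a) ⟩
    0ℚ
      ∎
    where open ≡-Reasoning

  ℓ-weights : ∀ X Y K M B → ℓ ((κ K ⊛ combination X ++ κ M ⊛ combination Y) ⊛ B) ≡
    K ℚ.* linearly (λ p → ℓ (p ⊛ B)) X ℚ.+ M ℚ.* linearly (λ p → ℓ (p ⊛ B)) Y
  ℓ-weights X Y K M B = begin
    ℓ ((κ K ⊛ combination X ++ κ M ⊛ combination Y) ⊛ B)
      ≡⟨ LS.solve 5 (λ k x m y b → (k LS.:* x LS.:+ m LS.:* y) LS.:* b LS.:= k LS.:* (x LS.:* b) LS.:+ m
          LS.:* (y LS.:* b)) ≈-refl (κ K) (combination X) (κ M) (combination Y) B .at _ ⟩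
    ℓ (κ K ⊛ (combination X ⊛ B) ++ κ M ⊛ (combination Y ⊛ B))
      ≡⟨ ⟦⟧-++ (κ K ⊛ (combination X ⊛ B)) (κ M ⊛ (combination Y ⊛ B)) _ ⟩
    ℓ (κ K ⊛ (combination X ⊛ B)) ℚ.+ ℓ (κ M ⊛ (combination Y ⊛ B))
      ≡⟨ cong₂ ℚ._+_ (⟦⟧-κ K (combination X ⊛ B) _) (⟦⟧-κ M (combination Y ⊛ B) _) ⟩
    K ℚ.* ℓ (combination X ⊛ B) ℚ.+ M ℚ.* ℓ (combination Y ⊛ B)
      ≡⟨ cong₂ (λ x y → K ℚ.* x ℚ.+ M ℚ.* y) (⟦⟧-combination X B _) (⟦⟧-combination Y B _) ⟩
    K ℚ.* linearly (λ p → ℓ (p ⊛ B)) X ℚ.+ M ℚ.* linearly (λ p → ℓ (p ⊛ B)) Y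
      ∎
    where open ≡-Reasoning

  moment : ℕ → Laurent → ℚ
  moment n A = ℓ (s ^ n ⊛ A)

  module _ {K M : ℚ} {A : Laurent} (w : Weighted K M A) (a : Antisymmetric A) where

    private
      μ ν : ℕ → ℚ
      μ n = moment n A
      ν n = moment n (S ⊛ A)

    relation₀ : sRelation₀ K M (μ 0) (μ 1) ≡ 0ℚ
    relation₀ = trans (sym expand) (ibp-vanish s hₛ ∂-s hₛ-sym a)
      where
      open ≡-Reasoning
      collect : ∀ {x} → x ≡ μ 1 →
        ι (+ 2) ℚ.* x ℚ.+ (K ℚ.* (ι (+ 3) ℚ.* x) ℚ.+ M ℚ.* (ι (+ 2) ℚ.* x ℚ.+ ι (+ 6) ℚ.* μ 0))
            ≡ sRelation₀ K M (μ 0) (μ 1)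
      collect refl = refl
      expand : ℓ (Δ s ⊛ A ++ Γ s A) ≡ sRelation₀ K M (μ 0) (μ 1)
      expand = begin
        ℓ (Δ s ⊛ A ++ Γ s A)
          ≡⟨ ++-cong (⊛-cong Δ-s (≈-refl {A})) (along-s w) .at _ ⟩
        ℓ (combination Δₛ ⊛ A ++ (κ K ⊛ combination Xₛ ++ κ M ⊛ combination Yₛ) ⊛ A)
          ≡⟨ ⟦⟧-++ (combination Δₛ ⊛ A) _ _ ⟩
        ℓ (combination Δₛ ⊛ A) ℚ.+ ℓ ((κ K ⊛ combination Xₛ ++ κ M ⊛ combination Yₛ) ⊛ A)
          ≡⟨ cong₂ ℚ._+_ (⟦⟧-combination Δₛ A _) (ℓ-weights Xₛ Yₛ K M A) ⟩
        linearly (λ p → ℓ (p ⊛ A)) Δₛ ℚ.+ (K ℚ.* linearly (λ p → ℓ (p ⊛ A)) Xₛ ℚ.+ M ℚ.* linearly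
            (λ p → ℓ (p ⊛ A)) Yₛ)
          ≡⟨ collect (⊛-cong (≈-sym (≈-trans (⊛-comm s one) (⊛-identityˡ s))) (≈-refl {A}) .at _) ⟩
        sRelation₀ K M (μ 0) (μ 1)
          ∎

    -- The power rule turns the gradient of s^(n+1) into (n + 1) sⁿ ∇s, and pairing it with ∇s gives
    -- |∇s|². Its expansion brings in the moment of `S` and the one of order n.
    relation : ∀ n → sRelation (suc n) K M (μ n) (μ (suc n)) (μ (2 + n)) (ν n) ≡ 0ℚ
    relation n = trans (sym expand) (ibp-vanish s hₛ ∂-s hₛ-sym (antisymmetric-s^ (suc n) a))
      where
      Q P E : Laurent
      Q = s ^ n ⊛ A
      P = s ^ suc n ⊛ A
      E = κ K ⊛ combination Xₛ ++ κ M ⊛ combination Yₛ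
      collect : ∀ {x y z t b c} → x ≡ μ (2 + n) → y ≡ μ (2 + n) → z ≡ ν n → t ≡ μ (suc n) → b ≡ μ n → c
          ≡ μ (suc n) →
        ι (+ 2) ℚ.* x
        ℚ.+ (ι (+ suc n) ℚ.* (+ 3 / 2 ℚ.* y ℚ.+ (ℚ.- (+ 1 / 2) ℚ.* z ℚ.+
            ((ℚ.- ι (+ 6)) ℚ.* t ℚ.+ (ℚ.- ι (+ 18)) ℚ.* b)))
        ℚ.+ (K ℚ.* (ι (+ 3) ℚ.* x) ℚ.+ M ℚ.* (ι (+ 2) ℚ.* x ℚ.+ ι (+ 6) ℚ.* c)))
        ≡ sRelation (suc n) K M (μ n) (μ (suc n)) (μ (2 + n)) (ν n)
      collect refl refl refl refl refl refl = refl
      ΓP : Γ s P ≈ κ (ι (+ suc n)) ⊛ (combination Γₛₛ ⊛ Q) ++ E ⊛ P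
      ΓP = begin
        Γ s (s ^ suc n ⊛ A)
          ≈⟨ Γ-⊛ s (s ^ suc n) A ⟩
        Γ s (s ^ suc n) ⊛ A ++ s ^ suc n ⊛ Γ s A
          ≈⟨ ++-cong (⊛-cong (≈-trans (Γ-^ s s n) (⊛-cong (≈-refl {κ (ι (+ suc n))})
              (⊛-cong (≈-refl {s ^ n}) Γ-s-s))) (≈-refl {A}))
                     (⊛-cong (≈-refl {s ^ suc n}) (along-s w)) ⟩
        (κ (ι (+ suc n)) ⊛ (s ^ n ⊛ combination Γₛₛ)) ⊛ A ++ s ^ suc n ⊛ (E ⊛ A)
          ≈⟨ LS.solve 6 (λ k sn g a sn′ e → (k LS.:* (sn LS.:* g)) LS.:* a LS.:+ sn′ LS.:* (e LS.:* a)
               LS.:= k LS.:* (g LS.:* (sn LS.:* a)) LS.:+ e LS.:* (sn′ LS.:* a)) ≈-refl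
               (κ (ι (+ suc n))) (s ^ n) (combination Γₛₛ) A (s ^ suc n) E ⟩
        κ (ι (+ suc n)) ⊛ (combination Γₛₛ ⊛ Q) ++ E ⊛ P
          ∎
        where open ≈-Reasoning
      expand : ℓ (Δ s ⊛ P ++ Γ s P) ≡ sRelation (suc n) K M (μ n) (μ (suc n)) (μ (2 + n)) (ν n)
      expand = begin
        ℓ (Δ s ⊛ P ++ Γ s P)
          ≡⟨ ++-cong (⊛-cong Δ-s (≈-refl {P})) ΓP .at _ ⟩
        ℓ (combination Δₛ ⊛ P ++ (κ (ι (+ suc n)) ⊛ (combination Γₛₛ ⊛ Q) ++ E ⊛ P))
          ≡⟨ trans (⟦⟧-++ (combination Δₛ ⊛ P) _ _)
              (cong (ℓ (combination Δₛ ⊛ P) ℚ.+_) (⟦⟧-++ (κ (ι (+ suc n)) ⊛ (combination Γₛₛ ⊛ Q)) (E ⊛ P) _)) ⟩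
        ℓ (combination Δₛ ⊛ P) ℚ.+ (ℓ (κ (ι (+ suc n)) ⊛ (combination Γₛₛ ⊛ Q)) ℚ.+ ℓ (E ⊛ P))
          ≡⟨ cong₂ ℚ._+_ (⟦⟧-combination Δₛ P _) (cong₂ ℚ._+_
               (trans (⟦⟧-κ (ι (+ suc n)) (combination Γₛₛ ⊛ Q) _)
                   (cong (ι (+ suc n) ℚ.*_) (⟦⟧-combination Γₛₛ Q _)))
               (ℓ-weights Xₛ Yₛ K M P)) ⟩
        linearly (λ p → ℓ (p ⊛ P)) Δₛ ℚ.+ (ι (+ suc n) ℚ.* linearly (λ p → ℓ (p ⊛ Q)) Γₛₛ
          ℚ.+ (K ℚ.* linearly (λ p → ℓ (p ⊛ P)) Xₛ ℚ.+ M ℚ.* linearly (λ p → ℓ (p ⊛ P)) Yₛ))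
          ≡⟨ collect
               (≈-sym (⊛-assoc s (s ^ suc n) A) .at _)
               (LS.solve 3 (λ s sn a → (s LS.:* s) LS.:* (sn LS.:* a) LS.:= (s LS.:* (s LS.:* sn))
                   LS.:* a) ≈-refl s (s ^ n) A .at _)
               (LS.solve 3 (λ t sn a → t LS.:* (sn LS.:* a) LS.:= sn LS.:* (t LS.:* a)) ≈-refl S
                   (s ^ n) A .at _)
               (≈-sym (⊛-assoc s (s ^ n) A) .at _)
               (⊛-identityˡ Q .at _)
               (⊛-identityˡ P .at _) ⟩
        sRelation (suc n) K M (μ n) (μ (suc n)) (μ (2 + n)) (ν n)
          ∎
        where open ≡-Reasoning

    relationS : SRelation K M (μ 0) (μ 1) (μ 2) (ν 0) ≡ 0ℚ
    relationS = trans (sym expand) (ibp-vanish S hS ∂-S hS-sym a)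
      where
      open ≡-Reasoning
      E : Laurent
      E = κ K ⊛ combination XS ++ κ M ⊛ combination YS
      collect : ∀ {x y z} → x ≡ μ 1 → y ≡ μ 2 → z ≡ ν 0 → SRelation K M (μ 0) x y z ≡ SRelation K M (μ 0)
          (μ 1) (μ 2) (ν 0)
      collect refl refl refl = refl
      expand : ℓ (Δ S ⊛ A ++ Γ S A) ≡ SRelation K M (μ 0) (μ 1) (μ 2) (ν 0)
      expand = begin
        ℓ (Δ S ⊛ A ++ Γ S A)
          ≡⟨ ++-cong (⊛-cong Δ-S (≈-refl {A})) (along-S w) .at _ ⟩
        ℓ (combination ΔS ⊛ A ++ E ⊛ A)
          ≡⟨ ⟦⟧-++ (combination ΔS ⊛ A) _ _ ⟩
        ℓ (combination ΔS ⊛ A) ℚ.+ ℓ (E ⊛ A)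
          ≡⟨ cong₂ ℚ._+_ (⟦⟧-combination ΔS A _) (ℓ-weights XS YS K M A) ⟩
        SRelation K M (μ 0) (ℓ (s ⊛ A)) (ℓ ((s ⊛ s) ⊛ A)) (ℓ (S ⊛ A))
          ≡⟨ collect
               (⊛-cong (≈-sym (≈-trans (⊛-comm s one) (⊛-identityˡ s))) (≈-refl {A}) .at _)
               (⊛-cong (⊛-cong (≈-refl {s}) (≈-sym (≈-trans (⊛-comm s one) (⊛-identityˡ s))))
                   (≈-refl {A}) .at _)
               (≈-sym (⊛-identityˡ (S ⊛ A)) .at _) ⟩
        SRelation K M (μ 0) (μ 1) (μ 2) (ν 0)
          ∎

  ℓ-N : ∀ {x y} B → ℓ (S ⊛ B) ≡ x → ℓ ((s ⊛ s) ⊛ B) ≡ y → ℓ (N ⊛ B) ≡ + 1 / 4 ℚ.* x ℚ.+ + 1 / 4 ℚ.* y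
  ℓ-N B refl refl = trans (⊛-cong N-s-S (≈-refl {B}) .at _)
      (⟦⟧-combination ((+ 1 / 4 , S) ∷ (+ 1 / 4 , s ⊛ s) ∷ []) B _)

  ℓ-D : ∀ A → ℓ (D ⊛ A) ≡ discriminantMoment
    (moment 0 A) (moment 2 A) (moment 3 A) (moment 4 A)
    (moment 0 (S ⊛ A)) (moment 1 (S ⊛ A)) (moment 2 (S ⊛ A)) (moment 0 (S ⊛ (S ⊛ A)))
  ℓ-D A = trans (⊛-cong D-s-S (≈-refl {A}) .at _) (trans
    (⟦⟧-combination ((ι (+ 27) , one) ∷ (ℚ.- ι (+ 18) , N) ∷ (ι (+ 1) , s ⊛ (s ⊛ s)) ∷
        (ℚ.- ι (+ 3) , s ⊛ S) ∷ (ℚ.- ι (+ 1) , N ⊛ N) ∷ []) A _)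
    (collect {ℓ (one ⊛ A)} {ℓ (N ⊛ A)} {y = ℓ ((s ⊛ (s ⊛ s)) ⊛ A)} {z = ℓ ((s ⊛ S) ⊛ A)} {t = ℓ ((N ⊛ N) ⊛ A)}
      (ℓ-N A (unit-S A) (square A)) cube mixed
      -- N² A is expanded by applying N = (S + s²)/4 twice, after commuting the inner `N` past `S`
      -- and past s².
      (trans (⊛-assoc N N A .at _) (ℓ-N (N ⊛ A)
        (trans (swap S N A) (ℓ-N (S ⊛ A) (unit-S (S ⊛ A)) (square (S ⊛ A))))
        (trans (swap (s ⊛ s) N A) (ℓ-N ((s ⊛ s) ⊛ A) (trans (swap S (s ⊛ s) A) (square (S ⊛ A))) fourth))))))
    where
    collect : ∀ {x₀ x x′ y y′ z z′ t t′} → x ≡ x′ → y ≡ y′ → z ≡ z′ → t ≡ t′ →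
      ι (+ 27) ℚ.* x₀ ℚ.+ ((ℚ.- ι (+ 18)) ℚ.* x ℚ.+
          (ι (+ 1) ℚ.* y ℚ.+ ((ℚ.- ι (+ 3)) ℚ.* z ℚ.+ (ℚ.- ι (+ 1)) ℚ.* t)))
      ≡ ι (+ 27) ℚ.* x₀ ℚ.+ ((ℚ.- ι (+ 18)) ℚ.* x′ ℚ.+
          (ι (+ 1) ℚ.* y′ ℚ.+ ((ℚ.- ι (+ 3)) ℚ.* z′ ℚ.+ (ℚ.- ι (+ 1)) ℚ.* t′)))
    collect refl refl refl refl = refl
    unit-S : ∀ B → ℓ (S ⊛ B) ≡ moment 0 (S ⊛ B)
    unit-S B = ≈-sym (⊛-identityˡ (S ⊛ B)) .at _
    swap : ∀ x y B → ℓ (x ⊛ (y ⊛ B)) ≡ ℓ (y ⊛ (x ⊛ B))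
    swap x y B = LS.solve 3 (λ x y b → x LS.:* (y LS.:* b) LS.:= y LS.:* (x LS.:* b)) ≈-refl x y B .at _
    square : ∀ B → ℓ ((s ⊛ s) ⊛ B) ≡ moment 2 B
    square B = LS.solve 2 (λ s b → (s LS.:* s) LS.:* b LS.:= (s LS.:* (s LS.:* LS.con 1))
        LS.:* b) ≈-refl s B .at _
    cube : ℓ ((s ⊛ (s ⊛ s)) ⊛ A) ≡ moment 3 A
    cube = LS.solve 2 (λ s a → (s LS.:* (s LS.:* s)) LS.:* a LS.:= (s LS.:* (s LS.:* (s LS.:* LS.con 1)))
        LS.:* a) ≈-refl s A .at _
    fourth : ℓ ((s ⊛ s) ⊛ ((s ⊛ s) ⊛ A)) ≡ moment 4 A
    fourth = LS.solve 2 (λ s a → (s LS.:* s) LS.:* ((s LS.:* s) LS.:* a)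
        LS.:= (s LS.:* (s LS.:* (s LS.:* (s LS.:* LS.con 1)))) LS.:* a) ≈-refl s A .at _
    mixed : ℓ ((s ⊛ S) ⊛ A) ≡ moment 1 (S ⊛ A)
    mixed = LS.solve 3 (λ s t a → (s LS.:* t) LS.:* a LS.:= (s LS.:* LS.con 1) LS.:*
        (t LS.:* a)) ≈-refl s S A .at _

  -- The induction must carry the first two fields as well: the next step uses the moment relations
  -- of `A`, not only its value.
  record Evaluated (a b : ℕ) (A : Laurent) : Set where
    field
      weighted      : Weighted (ι (+ a)) (ι (+ b)) A
      antisymmetric : Antisymmetric A
      value         : ℓ A ≡ G a b

  open Evaluated

  evaluated-cong : ∀ {a b A B} → A ≈ B → Evaluated a b A → Evaluated a b B
  evaluated-cong e g = record
    { weighted = weighted-cong e (weighted g)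
    ; antisymmetric = antisymmetric-cong e (antisymmetric g)
    ; value = trans (sym (e .at _)) (value g) }

  weighted-S⊛ : ∀ {K M A} → Weighted K M A → Weighted K (M ℚ.+ ι (+ 2)) (S ⊛ A)
  weighted-S⊛ {K} {M} {A} w = subst₂ (λ K M → Weighted K M (S ⊛ A)) (ℚ.+-identityˡ K)
      (ℚ.+-comm (ι (+ 2)) M) (weighted-⊛ weighted-S w)

  module _ (a b : ℕ) {A : Laurent} (g : Evaluated a b A) where

    private
      K₀ M₀ M₂ : ℚ
      K₀ = ι (+ a)
      M₀ = ι (+ b)
      M₂ = M₀ ℚ.+ ι (+ 2)
      M₂≡ : M₂ ≡ ι (+ (2 + b))
      M₂≡ = trans (ℚ.+-comm M₀ (ι (+ 2))) (sym (ι-+ (+ 2) (+ b)))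
      cancel : Cancellative K₀ M₀
      cancel = linear-cancel a b
      cancel′ : Cancellative K₀ M₂
      cancel′ = subst (Cancellative K₀) (sym M₂≡) (linear-cancel a (2 + b))
      wA : Weighted K₀ M₀ A
      wA = weighted g
      aA : Antisymmetric A
      aA = antisymmetric g
      μ₀≡G : moment 0 A ≡ G a b
      μ₀≡G = trans (⊛-identityˡ A .at _) (value g)
      aSA : Antisymmetric (S ⊛ A)
      aSA = antisymmetric-⊛ ρ-S τ-S aA
      wSA : Weighted K₀ M₂ (S ⊛ A)
      wSA = weighted-S⊛ wA
      divide : ∀ c d e x → ∃[ y ] linear c d (suc e) K₀ M₀ ℚ.* y ≡ x
      divide = linear-divides a b

    moment-S : ℓ (S ⊛ A) ≡ G a (2 + b)
    moment-S = trans (≈-sym (⊛-identityˡ (S ⊛ A)) .at _)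
      (S-step K₀ M₀ cancel divide {μ₁ = moment 1 A} {moment 2 A} (relation₀ wA aA) (relation wA aA 0)
          (relationS wA aA)
        (trans (G-step-M a b) (cong (M-numerator K₀ M₀ ℚ.*_) (sym μ₀≡G))))

    -- Five of the eight relations are those of `A`; the other three are those of `S ⊛ A`, at M + 2.
    moment-D : ℓ (D ⊛ A) ≡ G (2 + a) b
    moment-D = trans (ℓ-D A)
      (D-step K₀ M₀ cancel divide cancel′ {μ₁ = moment 1 A} {moment 2 A} {moment 3 A} {moment 4 A}
          {moment 0 (S ⊛ A)} {moment 1 (S ⊛ A)} {moment 2 (S ⊛ A)} {moment 0 (S ⊛ (S ⊛ A))}
        (relation₀ wA aA) (relation wA aA 0) (relationS wA aA)
        (relation₀ wSA aSA) (relation wSA aSA 0) (relationS wSA aSA)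
        (relation wA aA 1) (relation wA aA 2)
        (trans (G-step-K a b) (cong (K-numerator K₀ M₀ ℚ.*_) (sym μ₀≡G))))

    evaluated-S : Evaluated a (2 + b) (S ⊛ A)
    evaluated-S = record
      { weighted = subst (λ M → Weighted K₀ M (S ⊛ A)) M₂≡ wSA
      ; antisymmetric = aSA
      ; value = moment-S }

    evaluated-D : Evaluated (2 + a) b (D ⊛ A)
    evaluated-D = record
      { weighted = subst₂ (λ K M → Weighted K M (D ⊛ A)) (sym (ι-+ (+ 2) (+ a))) (ℚ.+-identityˡ M₀)
          (weighted-⊛ weighted-D wA)
      ; antisymmetric = antisymmetric-⊛ ρ-D τ-D aA
      ; value = moment-D }

  evaluated-S^ : ∀ m {a b A} → Evaluated a b A → Evaluated a (2 * m + b) (S ^ m ⊛ A)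
  evaluated-S^ zero    {A = A} g = evaluated-cong (≈-sym (⊛-identityˡ A)) g
  evaluated-S^ (suc m) {a} {b} {A} g = evaluated-cong (≈-sym (⊛-assoc S (S ^ m) A))
    (subst (λ b → Evaluated a b (S ⊛ (S ^ m ⊛ A))) (cong (_+ b) (sym (ℕ.*-suc 2 m)))
        (evaluated-S a (2 * m + b) (evaluated-S^ m g)))

  evaluated-D^ : ∀ k {a b A} → Evaluated a b A → Evaluated (2 * k + a) b (D ^ k ⊛ A)
  evaluated-D^ zero    {A = A} g = evaluated-cong (≈-sym (⊛-identityˡ A)) g
  evaluated-D^ (suc k) {a} {b} {A} g = evaluated-cong (≈-sym (⊛-assoc D (D ^ k) A))
    (subst (λ a → Evaluated a b (D ⊛ (D ^ k ⊛ A))) (cong (_+ a) (sym (ℕ.*-suc 2 k)))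
        (evaluated-D (2 * k + a) b (evaluated-D^ k g)))

-- On the plane spanned by the roots these are the reflections in α₂ and α₁.
τₗ τₛ : Weight → Weight
τₗ (x ∷ y ∷ z ∷ []) = ℤ.- z ∷ ℤ.- y ∷ ℤ.- x ∷ []
τₛ (x ∷ y ∷ z ∷ []) = y ∷ x ∷ z ∷ []

τₗ-auto : Automorphism τₗ
τₗ-auto = record
  { homo = λ { (x ∷ y ∷ z ∷ []) (x′ ∷ y′ ∷ z′ ∷ []) → cong₂ _∷_ (ℤ.neg-distrib-+ z z′)
      (cong₂ _∷_ (ℤ.neg-distrib-+ y y′) (cong₂ _∷_ (ℤ.neg-distrib-+ x x′) refl)) }
  ; preserves = refl
  ; reflects = τₗ-reflects }
  where
  τₗ-reflects : ∀ u → τₗ u ≡ 𝟎 → u ≡ 𝟎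
  τₗ-reflects (+ 0 ∷ + 0 ∷ + 0 ∷ []) refl = refl

τₛ-auto : Automorphism τₛ
τₛ-auto = record
  { homo = λ { (_ ∷ _ ∷ _ ∷ []) (_ ∷ _ ∷ _ ∷ []) → refl }
  ; preserves = refl
  ; reflects = λ { (_ ∷ _ ∷ _ ∷ []) refl → refl } }

opaque
  unfolding κ s

  longWall : Wall α₂
  longWall = record
    { unit = refl ; τ = τₗ ; τ-auto = τₗ-auto
    ; τ-s = ≈-by-computation _ _ tt
    ; τ-S = ≈-by-computation _ _ tt
    ; τ-D = ≈-by-computation _ _ tt
    -- `h c` divides a derivative along α₂ by 1 - e^α₂: that of `s` for c = -3, that of `d` for c =
    -- 3. The latter is divisible because the reflection in α₂ fixes `d`; then S = -d² gives `hS`.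
    ; hₛ = h (ℚ.- ι (+ 3))
    ; hS = κ (ℚ.- ι (+ 2)) ⊛ (d ⊛ h (ι (+ 3)))
    ; ∂-s = ≈-by-computation _ _ tt
    ; ∂-S = ≈-by-computation _ _ tt
    ; hₛ-sym = ≈-by-computation _ _ tt
    ; hS-sym = ≈-by-computation _ _ tt
    }
    where
    h : ℚ → Laurent
    h c = (ℚ.- ι (+ 3) , α₁) ∷ (c , ⊖ (α₁ ⊕ α₂)) ∷ []

  shortWall : Wall α₁
  shortWall = record
    { unit = refl ; τ = τₛ ; τ-auto = τₛ-auto
    ; τ-s = ≈-by-computation _ _ tt
    ; τ-S = ≈-by-computation _ _ tt
    ; τ-D = ≈-by-computation _ _ tt
    ; hₛ = (ℚ.- ι (+ 2) , 𝟎) ∷ (ℚ.- ι (+ 2) , ⊖ α₁) ∷ (ℚ.- 1ℚ , α₁ ⊕ α₂) ∷ (ℚ.- 1ℚ , ⊖ (2 · α₁ ⊕ α₂)) ∷ []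
    -- Here the factor 1 - e^α₁ comes from `d` itself and not from its derivative: d = -(1 - e^α₁)(1
    -- - e^(α₁+α₂))(1 - e^(-2α₁-α₂)), and the derivative of S = -d² is -2 d times that of `d`.
    ; hS = κ (ι (+ 2)) ⊛ (∂ α₁ d ⊛ (1-e^ (α₁ ⊕ α₂) ⊛ 1-e^ (⊖ (2 · α₁ ⊕ α₂))))
    ; ∂-s = ≈-by-computation _ _ tt
    ; ∂-S = ≈-by-computation _ _ tt
    ; hₛ-sym = ≈-by-computation _ _ tt
    ; hS-sym = ≈-by-computation _ _ tt
    }

  -- Only finitely many coefficients of the logarithm meet `V`, so its value and `G 1 0` are
  -- computed outright; both are 1.
  evaluated-V : Evaluated longWall 1 0 V
  evaluated-V = record
    { weighted = weighted-V
    ; antisymmetric = record { under-ρ = ≈-by-computation _ _ tt ; under-τ = ≈-by-computation _ _ tt }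
    ; value = refl }

  evaluated-d : Evaluated shortWall 0 1 d
  evaluated-d = record
    { weighted = weighted-d
    ; antisymmetric = record { under-ρ = ≈-by-computation _ _ tt ; under-τ = ≈-by-computation _ _ tt }
    ; value = refl }

-- The stated constant terms as values of `logCT`

⋆-⊛ : ∀ p q F v → (p ⋆ q ⋆ F) v ≡ ((p ⊛ q) ⋆ F) v
⋆-⊛ p q F v = trans (⟦⟧-cong p (λ u → ⟦⟧-cong q (λ w → cong F (⊝-⊝ v u w)))) (sym (⟦⟧-⊛ p q _))
  where
  ⊝-⊝ : ∀ v u w → v ⊝ u ⊝ w ≡ v ⊝ (u ⊕ w)
  ⊝-⊝ v u w = trans (⊕-assoc v (⊖ u) (⊖ w)) (cong (v ⊕_) (⊖-⊕ u w))
    where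
    ⊖-⊕ : ∀ u w → ⊖ u ⊕ ⊖ w ≡ ⊖ (u ⊕ w)
    ⊖-⊕ (x ∷ y ∷ z ∷ []) (x′ ∷ y′ ∷ z′ ∷ []) = sym (cong₂ _∷_ (ℤ.neg-distrib-+ x x′)
      (cong₂ _∷_ (ℤ.neg-distrib-+ y y′) (cong₂ _∷_ (ℤ.neg-distrib-+ z z′) refl)))

⋆-congʳ : ∀ p {F H : Formal} → (∀ v → F v ≡ H v) → ∀ v → (p ⋆ F) v ≡ (p ⋆ H) v
⋆-congʳ p e v = ⟦⟧-cong p (λ u → e (v ⊝ u))

one-^ : ∀ n → one ^ n ≈ one
one-^ zero    = ≈-refl
one-^ (suc n) = ≈-trans (⊛-identityˡ (one ^ n)) (one-^ n)

⊛-^ : ∀ p q n → (p ⊛ q) ^ n ≈ p ^ n ⊛ q ^ n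
⊛-^ p q zero    = ≈-sym (⊛-identityˡ one)
⊛-^ p q (suc n) = ≈-trans (⊛-cong (≈-refl {p ⊛ q}) (⊛-^ p q n))
  (LS.solve 4 (λ p q a b → (p LS.:* q) LS.:* (a LS.:* b) LS.:= (p LS.:* a) LS.:* (q LS.:* b)) ≈-refl p q
      (p ^ n) (q ^ n))

∏-^ : ∀ vs f n → ∏ vs (λ v → f v ^ n) ≈ ∏ vs f ^ n
∏-^ []       f n = ≈-sym (one-^ n)
∏-^ (v ∷ vs) f n = ≈-trans (⊛-cong (≈-refl {f v ^ n}) (∏-^ vs f n)) (≈-sym (⊛-^ (f v) (∏ vs f) n))

CT-product : ∀ p₁ p₂ p₃ p₄ β →
  CT (p₁ ⋆ p₂ ⋆ p₃ ⋆ p₄ ⋆ log[1-e^ β ]) ≡ logCT β (p₃ ⊛ (p₄ ⊛ (p₁ ⊛ p₂)))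
CT-product p₁ p₂ p₃ p₄ β = begin
  CT (p₁ ⋆ p₂ ⋆ p₃ ⋆ p₄ ⋆ Λ)          ≡⟨ ⋆-⊛ p₁ p₂ (p₃ ⋆ p₄ ⋆ Λ) 𝟎 ⟩
  CT ((p₁ ⊛ p₂) ⋆ p₃ ⋆ p₄ ⋆ Λ)        ≡⟨ ⋆-congʳ (p₁ ⊛ p₂) (⋆-⊛ p₃ p₄ Λ) 𝟎 ⟩
  CT ((p₁ ⊛ p₂) ⋆ (p₃ ⊛ p₄) ⋆ Λ)      ≡⟨ ⋆-⊛ (p₁ ⊛ p₂) (p₃ ⊛ p₄) Λ 𝟎 ⟩
  logCT β ((p₁ ⊛ p₂) ⊛ (p₃ ⊛ p₄))     ≡⟨ LS.solve 3
      (λ x y z → x LS.:* (y LS.:* z) LS.:= y LS.:* (z LS.:* x)) ≈-refl (p₁ ⊛ p₂) p₃ p₄ .at _ ⟩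
  logCT β (p₃ ⊛ (p₄ ⊛ (p₁ ⊛ p₂)))     ∎
  where
  open ≡-Reasoning
  Λ : Formal
  Λ = log[1-e^ β ]

opaque
  unfolding s

  power-products : ∀ β k m A →
    logCT β (∏ Φₗ (λ α → (1-e^ α) ^ k) ⊛ (∏ Φₛ (λ α → (1-e^ α) ^ m) ⊛ A)) ≡ logCT β (D ^ k ⊛ (S ^ m ⊛ A))
  power-products β k m A = ⊛-cong (∏-^ Φₗ 1-e^_ k) (⊛-cong (∏-^ Φₛ 1-e^_ m) (≈-refl {A})) .at _

  V≡ : e^ (⊖ (3 · α₁) ⊝ 2 · α₂) ⊛ ∏ Φₗ⁺ (λ α → 1-e^ α) ≡ V
  V≡ = refl

  d≡ : e^ (⊖ (2 · α₁) ⊝ α₂) ⊛ ∏ Φₛ⁺ (λ α → 1-e^ α) ≡ d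
  d≡ = refl

theorem6p2 : (k m : ℕ) →
    ( CT ( e^ (⊖ (3 · α₁) ⊝ 2 · α₂)
    ⋆ ∏ Φₗ⁺ (λ α → 1-e^ α)
    ⋆ ∏ Φₗ (λ α → (1-e^ α) ^ k)
    ⋆ ∏ Φₛ (λ α → (1-e^ α) ^ m)
    ⋆ log[1-e^ α₂ ] )
    ≡ G (2 * k + 1) (2 * m) )
    ×
    ( CT ( e^ (⊖ (2 · α₁) ⊝ α₂)
    ⋆ ∏ Φₛ⁺ (λ α → 1-e^ α)
    ⋆ ∏ Φₗ (λ α → (1-e^ α) ^ k)
    ⋆ ∏ Φₛ (λ α → (1-e^ α) ^ m)
    ⋆ log[1-e^ α₁ ] )
    ≡ G (2 * k) (2 * m + 1) )
theorem6p2 k m = long , short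
  where
  open ≡-Reasoning
  long = begin
    _
      ≡⟨ CT-product (e^ (⊖ (3 · α₁) ⊝ 2 · α₂)) (∏ Φₗ⁺ (λ α → 1-e^ α)) (∏ Φₗ (λ α → (1-e^ α) ^ k))
          (∏ Φₛ (λ α → (1-e^ α) ^ m)) α₂ ⟩
    logCT α₂ (∏ Φₗ (λ α → (1-e^ α) ^ k) ⊛ (∏ Φₛ (λ α → (1-e^ α) ^ m) ⊛
        (e^ (⊖ (3 · α₁) ⊝ 2 · α₂) ⊛ ∏ Φₗ⁺ (λ α → 1-e^ α))))
      ≡⟨ power-products α₂ k m (e^ (⊖ (3 · α₁) ⊝ 2 · α₂) ⊛ ∏ Φₗ⁺ (λ α → 1-e^ α)) ⟩
    logCT α₂ (D ^ k ⊛ (S ^ m ⊛ (e^ (⊖ (3 · α₁) ⊝ 2 · α₂) ⊛ ∏ Φₗ⁺ (λ α → 1-e^ α))))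
      ≡⟨ cong (λ A → logCT α₂ (D ^ k ⊛ (S ^ m ⊛ A))) V≡ ⟩
    logCT α₂ (D ^ k ⊛ (S ^ m ⊛ V))
      ≡⟨ Evaluated.value (evaluated-D^ longWall k (evaluated-S^ longWall m evaluated-V)) ⟩
    G (2 * k + 1) (2 * m + 0)
      ≡⟨ cong (G (2 * k + 1)) (ℕ.+-identityʳ (2 * m)) ⟩
    G (2 * k + 1) (2 * m)
      ∎
  short = begin
    _
      ≡⟨ CT-product (e^ (⊖ (2 · α₁) ⊝ α₂)) (∏ Φₛ⁺ (λ α → 1-e^ α)) (∏ Φₗ (λ α → (1-e^ α) ^ k))
          (∏ Φₛ (λ α → (1-e^ α) ^ m)) α₁ ⟩
    logCT α₁ (∏ Φₗ (λ α → (1-e^ α) ^ k) ⊛ (∏ Φₛ (λ α → (1-e^ α) ^ m) ⊛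
        (e^ (⊖ (2 · α₁) ⊝ α₂) ⊛ ∏ Φₛ⁺ (λ α → 1-e^ α))))
      ≡⟨ power-products α₁ k m (e^ (⊖ (2 · α₁) ⊝ α₂) ⊛ ∏ Φₛ⁺ (λ α → 1-e^ α)) ⟩
    logCT α₁ (D ^ k ⊛ (S ^ m ⊛ (e^ (⊖ (2 · α₁) ⊝ α₂) ⊛ ∏ Φₛ⁺ (λ α → 1-e^ α))))
      ≡⟨ cong (λ A → logCT α₁ (D ^ k ⊛ (S ^ m ⊛ A))) d≡ ⟩
    logCT α₁ (D ^ k ⊛ (S ^ m ⊛ d))
      ≡⟨ Evaluated.value (evaluated-D^ shortWall k (evaluated-S^ shortWall m evaluated-d)) ⟩
    G (2 * k + 0) (2 * m + 1)
      ≡⟨ cong (λ a → G a (2 * m + 1)) (ℕ.+-identityʳ (2 * k)) ⟩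
    G (2 * k) (2 * m + 1)
      ∎
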